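{- Let $k,n$ be natural numbers (possibly $0$) and let $\varphi$ be a first-order formula. Then the following hold: 1. $\varphi\in\mathcal{E}_k^n$ if and only if there exists $\psi\in\Sigma_k^+$ such that $\varphi \rightsquigarrow^*_n \psi$; 2. $\varphi\in\mathcal{U}_k^n$ if and only if there exists $\psi\in\Pi_k^+$ such that $\varphi \rightsquigarrow^*_n \psi$.
   Context: Formulas are those of a first-order language with logical constants $\forall,\exists,\to,\land,\lor,\perp$. $\mathrm{FV}(\varphi)$ is the set of free variables of $\varphi$. An overlined $\overline{x}$ is a non-empty list of variables; $\exists\overline{x}$ and $\forall\overline{x}$ are lists of quantifiers of the same kind. Prenex classes. $\Sigma_0=\Pi_0$ is the class of quantifier-free formulas; $\Sigma_{k+1}=\{\exists\overline{x}\,\varphi\mid\varphi\in\Pi_k\}$; $\Pi_{k+1}=\{\forall\overline{x}\,\varphi\mid\varphi\in\Sigma_k\}$. $\Sigma_k^+=\Sigma_k\cup\bigcup_{i<k}(\Sigma_i\cup\Pi_i)$ and $\Pi_k^+=\Pi_k\cup\bigcup_{i<k}(\Sigma_i\cup\Pi_i)$. A formula is in prenex normal form if it is in $\Sigma_k\cup\Pi_k$ for some $k$. Classes $\mathcal{E}^n_k,\mathcal{U}^n_k,\mathcal{D}^n_k$. For each $n$, $\mathcal{D}^n_0=\mathcal{E}^n_0=\mathcal{U}^n_0$ is the set of quantifier-free formulas. Given $\mathcal{E}^n_k$ and $\mathcal{U}^n_k$, put $\mathcal{D}^n_k=\mathcal{E}^n_k\cup\mathcal{U}^n_k$; then $\mathcal{E}^n_{k+1}$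 and $\mathcal{U}^n_{k+1}$ are simultaneously inductively generated by the following clauses, where $D$ ranges over $\mathcal{D}^n_k$, $E,E'$ over $\mathcal{E}^n_{k+1}$, and $U,U'$ over $\mathcal{U}^n_{k+1}$: - if $n>k$: $D,\ E\land E',\ E\lor E',\ U\to E,\ \exists xE\in\mathcal{E}^n_{k+1}$; and $D,\ U\land U',\ U\lor U',\ E\to U,\ \forall xU\in\mathcal{U}^n_{k+1}$; - if $n=k$: $D,\ E\land E',\ E\lor E',\ D\to E,\ \exists xE\in\mathcal{E}^n_{k+1}$; and $D,\ U\land U',\ U\lor D,\ D\lor U,\ E\to U,\ \forall xU\in\mathcal{U}^n_{k+1}$; - if $n<k$: with $D_0$ ranging over $\mathcal{D}^n_n$ and $E_1$ over $\mathcal{E}^n_{n+1}$: $D,\ E\land E',\ E\lor E_1,\ E_1\lor E,\ D_0\to E,\ \exists xE\in\mathcal{E}^n_{k+1}$; and $D,\ U\land U',\ U\lor D_0,\ D_0\lor U,\ E_1\to U,\ \forall xU\in\mathcal{U}^n_{k+1}$. Classes $\mathrm{E}_k^+,\mathrm{U}_k^+,\mathrm{C}_k^+$. An alternation path is a finite sequence in which the symbols $+$ and $-$ alternate; $l(s)$ is its length, $i(s)$ its first symbol (undefined, hence neither $+$ nor $-$, for the empty path $\langle\rangle$), and $s^\perp$ is $s$ with $+$ and $-$ switched. Define $\mathrm{Alt}(\varphi)$: if $\varphi$ is quantifier-free, $\mathrm{Alt}(\varphi)=\{\langle\rangle\}$; otherwise $\mathrm{Alt}(\varphi_1\land\varphi_2)=\mathrm{Alt}(\varphi_1\lor\varphi_2)=\mathrm{Alt}(\varphi_1)\cup\mathrm{Alt}(\varphi_2)$;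 $\mathrm{Alt}(\varphi_1\to\varphi_2)=\{s^\perp\mid s\in\mathrm{Alt}(\varphi_1)\}\cup\mathrm{Alt}(\varphi_2)$; $\mathrm{Alt}(\forall x\varphi_1)=\{s\in\mathrm{Alt}(\varphi_1)\mid i(s)=-\}\cup\{ -s\mid s\in\mathrm{Alt}(\varphi_1),\,i(s)\neq-\}$; $\mathrm{Alt}(\exists x\varphi_1)=\{s\in\mathrm{Alt}(\varphi_1)\mid i(s)=+\}\cup\{+s\mid s\in\mathrm{Alt}(\varphi_1),\,i(s)\neq+\}$. Let $\deg(\varphi)=\max\{l(s)\mid s\in\mathrm{Alt}(\varphi)\}$, $\mathrm{F}_k=\{\varphi\mid\deg(\varphi)=k\}$, $\mathrm{E}_0=\mathrm{U}_0=\mathrm{F}_0$, $\mathrm{E}_{k+1}$ (resp. $\mathrm{U}_{k+1}$) the set of $\varphi\in\mathrm{F}_{k+1}$ such that $i(s)=+$ (resp. $i(s)=-$) for all $s\in\mathrm{Alt}(\varphi)$ with $l(s)=k+1$. Then $\mathrm{E}_k^+=\mathrm{E}_k\cup\bigcup_{i<k}\mathrm{F}_i$, $\mathrm{U}_k^+=\mathrm{U}_k\cup\bigcup_{i<k}\mathrm{F}_i$, $\mathrm{C}_k^+=\mathrm{E}_k^+\cup\mathrm{U}_k^+$. Relation $\rightsquigarrow^*_n$. $\varphi\rightsquigarrow^*_n\psi$ means that $\psi$ is obtained from $\varphi$ by finitely many (possibly zero) successive steps, each replacing a subformula occurrence, all of whose proper subformulas are in prenex normal form, according to one of the following rules (always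 $x\notin\mathrm{FV}(\delta)$, and $y$ does not appear in $\xi$): $(\exists\to)$: $\exists x\xi(x)\to\delta\rightsquigarrow\forall x(\xi(x)\to\delta)$; $(\forall\to)_n$ (available only if $n\neq0$): $\forall x\xi(x)\to\delta\rightsquigarrow\exists x(\xi(x)\to\delta)$, with $\xi(x)\in\mathrm{U}_n^+$; $(\to\exists)_n$: $\delta\to\exists x\xi(x)\rightsquigarrow\exists x(\delta\to\xi(x))$, with $\delta\in\mathrm{C}_n^+$; $(\to\forall)$: $\delta\to\forall x\xi(x)\rightsquigarrow\forall x(\delta\to\xi(x))$; for $Q\in\{\exists,\forall\}$: $Qx\xi(x)\land\delta\rightsquigarrow Qx(\xi(x)\land\delta)$ and $\delta\land Qx\xi(x)\rightsquigarrow Qx(\delta\land\xi(x))$; $(\exists\lor)$: $\exists x\xi(x)\lor\delta\rightsquigarrow\exists x(\xi(x)\lor\delta)$; $(\lor\exists)$: $\delta\lor\exists x\xi(x)\rightsquigarrow\exists x(\delta\lor\xi(x))$; $(\forall\lor)_n$: $\forall x\xi(x)\lor\delta\rightsquigarrow\forall x(\xi(x)\lor\delta)$, with $\delta\in\mathrm{C}_n^+$; $(\lor\forall)_n$: $\delta\lor\forall x\xi(x)\rightsquigarrow\forall x(\delta\lor\xi(x))$, with $\delta\in\mathrm{C}_n^+$; $(\exists\text{ -var})$: $\exists x\xi(x)\rightsquigarrow\exists y\xi(y)$; $(\forall\text{ -var})$: $\forall x\xi(x)\rightsquigarrow\forall y\xi(y)$. -}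

module Defs where

open import Data.Empty using (⊥)
open import Data.List.Base using (List; []; _∷_; _++_; head; length; map)
open import Data.List.Extrema.Nat using (max)
open import Data.List.Membership.Propositional using (_∈_)
open import Data.List.NonEmpty.Base as List⁺ using (List⁺)
open import Data.Maybe.Base using (just)
open import Data.Nat.Base using (ℕ; zero; suc; _<_; _>_)
open import Data.Nat.Properties using (_≟_)
open import Data.Product.Base using (∃-syntax; _×_)
open import Data.Sign.Base using (Sign; opposite) renaming (+ to ⊕; - to ⊖)
open import Data.Sum.Base using (_⊎_)
open import Data.Vec.Base using (Vec; []; _∷_)
open import Data.Vec.Relation.Unary.Any using (Any)
open import Relation.Binary.Construct.Closure.ReflexiveTransitive using (Star)
open import Relation.Binary.Construct.Closure.Transitive using (TransClosure)
open import Relation.Binary.PropositionalEquality.Core using (_≡_; _≢_)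
open import Relation.Nullary.Decidable.Core using (yes; no)
open import Relation.Nullary.Negation.Core using (¬_)

------------------------------------------------------------------------
-- First-order syntax with named variables

record Signature : Set₁ where
  field
    Fun     : Set
    Rel     : Set
    arityᶠ  : Fun → ℕ
    arityʳ  : Rel → ℕ

open Signature public

Var : Set
Var = ℕ

data Term (L : Signature) : Set where
  var : Var → Term L
  fun : (f : Fun L) → Vec (Term L) (arityᶠ L f) → Term L

infixr 7 _∧_
infixr 6 _∨_
infixr 5 _⇒_

data Formula (L : Signature) : Set where
  rel         : (R : Rel L) → Vec (Term L) (arityʳ L R) → Formula L
  ⊥′          : Formula L
  _∧_ _∨_ _⇒_ : Formula L → Formula L → Formula L
  ∀′ ∃′       : Var → Formula L → Formula L

variable
  L : Signature

data _∈ᵗ_ {L : Signature} (x : Var) : Term L → Set where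
  var : x ∈ᵗ var x
  fun : ∀ {f ts} → Any (x ∈ᵗ_) ts → x ∈ᵗ fun f ts

_∈FV_ : Var → Formula L → Set
x ∈FV rel R ts = Any (x ∈ᵗ_) ts
x ∈FV ⊥′       = ⊥
x ∈FV (φ ∧ ψ)  = x ∈FV φ ⊎ x ∈FV ψ
x ∈FV (φ ∨ ψ)  = x ∈FV φ ⊎ x ∈FV ψ
x ∈FV (φ ⇒ ψ)  = x ∈FV φ ⊎ x ∈FV ψ
x ∈FV ∀′ y φ   = x ≢ y × x ∈FV φ
x ∈FV ∃′ y φ   = x ≢ y × x ∈FV φ

-- Any appearance counts: free, bound, or as the variable of a quantifier.
_appearsIn_ : Var → Formula L → Set
x appearsIn rel R ts = Any (x ∈ᵗ_) ts
x appearsIn ⊥′       = ⊥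
x appearsIn (φ ∧ ψ)  = x appearsIn φ ⊎ x appearsIn ψ
x appearsIn (φ ∨ ψ)  = x appearsIn φ ⊎ x appearsIn ψ
x appearsIn (φ ⇒ ψ)  = x appearsIn φ ⊎ x appearsIn ψ
x appearsIn ∀′ y φ   = x ≡ y ⊎ x appearsIn φ
x appearsIn ∃′ y φ   = x ≡ y ⊎ x appearsIn φ

mutual
  _[_≔_]ᵗ : Term L → Var → Var → Term L
  var z    [ x ≔ y ]ᵗ with z ≟ x
  ... | yes _ = var y
  ... | no  _ = var z
  fun f ts [ x ≔ y ]ᵗ = fun f (ts [ x ≔ y ]ᵗˢ)

  _[_≔_]ᵗˢ : ∀ {m} → Vec (Term L) m → Var → Var → Vec (Term L) m
  []       [ x ≔ y ]ᵗˢ = []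
  (t ∷ ts) [ x ≔ y ]ᵗˢ = (t [ x ≔ y ]ᵗ) ∷ (ts [ x ≔ y ]ᵗˢ)

-- φ [ x ≔ y ] replaces the free occurrences of x by y.  It does not guard
-- against capture; it is only used below when y does not appear in φ.
_[_≔_] : Formula L → Var → Var → Formula L
rel R ts [ x ≔ y ] = rel R (ts [ x ≔ y ]ᵗˢ)
⊥′       [ x ≔ y ] = ⊥′
(φ ∧ ψ)  [ x ≔ y ] = (φ [ x ≔ y ]) ∧ (ψ [ x ≔ y ])
(φ ∨ ψ)  [ x ≔ y ] = (φ [ x ≔ y ]) ∨ (ψ [ x ≔ y ])
(φ ⇒ ψ)  [ x ≔ y ] = (φ [ x ≔ y ]) ⇒ (ψ [ x ≔ y ])
∀′ z φ   [ x ≔ y ] with z ≟ x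
... | yes _ = ∀′ z φ
... | no  _ = ∀′ z (φ [ x ≔ y ])
∃′ z φ   [ x ≔ y ] with z ≟ x
... | yes _ = ∃′ z φ
... | no  _ = ∃′ z (φ [ x ≔ y ])

data _◂_ {L : Signature} : Formula L → Formula L → Set where
  ∧ˡ : ∀ {φ ψ} → φ ◂ (φ ∧ ψ)
  ∧ʳ : ∀ {φ ψ} → ψ ◂ (φ ∧ ψ)
  ∨ˡ : ∀ {φ ψ} → φ ◂ (φ ∨ ψ)
  ∨ʳ : ∀ {φ ψ} → ψ ◂ (φ ∨ ψ)
  ⇒ˡ : ∀ {φ ψ} → φ ◂ (φ ⇒ ψ)
  ⇒ʳ : ∀ {φ ψ} → ψ ◂ (φ ⇒ ψ)
  ∀◂ : ∀ {x φ} → φ ◂ ∀′ x φ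
  ∃◂ : ∀ {x φ} → φ ◂ ∃′ x φ

ProperSubformula : Formula L → Formula L → Set
ProperSubformula = TransClosure _◂_

data QuantifierFree {L : Signature} : Formula L → Set where
  rel : ∀ {R ts} → QuantifierFree (rel R ts)
  ⊥′  : QuantifierFree ⊥′
  _∧_ : ∀ {φ ψ} → QuantifierFree φ → QuantifierFree ψ → QuantifierFree (φ ∧ ψ)
  _∨_ : ∀ {φ ψ} → QuantifierFree φ → QuantifierFree ψ → QuantifierFree (φ ∨ ψ)
  _⇒_ : ∀ {φ ψ} → QuantifierFree φ → QuantifierFree ψ → QuantifierFree (φ ⇒ ψ)

------------------------------------------------------------------------
-- Prenex classes

∀* ∃* : List⁺ Var → Formula L → Formula L
∀* xs φ = List⁺.foldr ∀′ (λ x → ∀′ x φ) xs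
∃* xs φ = List⁺.foldr ∃′ (λ x → ∃′ x φ) xs

mutual
  IsΣ : ℕ → Formula L → Set
  IsΣ zero    φ = QuantifierFree φ
  IsΣ (suc k) φ = ∃[ xs ] ∃[ ψ ] (φ ≡ ∃* xs ψ × IsΠ k ψ)

  IsΠ : ℕ → Formula L → Set
  IsΠ zero    φ = QuantifierFree φ
  IsΠ (suc k) φ = ∃[ xs ] ∃[ ψ ] (φ ≡ ∀* xs ψ × IsΣ k ψ)

IsΣ⁺ IsΠ⁺ : ℕ → Formula L → Set
IsΣ⁺ k φ = IsΣ k φ ⊎ ∃[ i ] (i < k × (IsΣ i φ ⊎ IsΠ i φ))
IsΠ⁺ k φ = IsΠ k φ ⊎ ∃[ i ] (i < k × (IsΣ i φ ⊎ IsΠ i φ))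

IsPrenex : Formula L → Set
IsPrenex φ = ∃[ k ] (IsΣ k φ ⊎ IsΠ k φ)

------------------------------------------------------------------------
-- The classes 𝓔ⁿₖ, 𝓤ⁿₖ, 𝓓ⁿₖ

-- The constructors for level suc k refer to lower levels and to level suc k
-- itself only, so this indexed family is the level-by-level inductive
-- definition.  The clauses shared by the cases n > k, n = k and n < k carry
-- no hypothesis on n and k; the others are marked >, ≡ and < accordingly.
mutual
  data 𝓔 {L : Signature} (n : ℕ) : ℕ → Formula L → Set where
    qf  : ∀ {φ} → QuantifierFree φ → 𝓔 n 0 φ

    𝓓→𝓔 : ∀ {k φ} → 𝓓 n k φ → 𝓔 n (suc k) φ
    and : ∀ {k φ ψ} → 𝓔 n (suc k) φ → 𝓔 n (suc k) ψ → 𝓔 n (suc k) (φ ∧ ψ)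
    ex  : ∀ {k x φ} → 𝓔 n (suc k) φ → 𝓔 n (suc k) (∃′ x φ)

    or>  : ∀ {k φ ψ} → n > k → 𝓔 n (suc k) φ → 𝓔 n (suc k) ψ → 𝓔 n (suc k) (φ ∨ ψ)
    imp> : ∀ {k φ ψ} → n > k → 𝓤 n (suc k) φ → 𝓔 n (suc k) ψ → 𝓔 n (suc k) (φ ⇒ ψ)

    or≡  : ∀ {k φ ψ} → n ≡ k → 𝓔 n (suc k) φ → 𝓔 n (suc k) ψ → 𝓔 n (suc k) (φ ∨ ψ)
    imp≡ : ∀ {k φ ψ} → n ≡ k → 𝓓 n k φ → 𝓔 n (suc k) ψ → 𝓔 n (suc k) (φ ⇒ ψ)

    orʳ< : ∀ {k φ ψ} → n < k → 𝓔 n (suc k) φ → 𝓔 n (suc n) ψ → 𝓔 n (suc k) (φ ∨ ψ)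
    orˡ< : ∀ {k φ ψ} → n < k → 𝓔 n (suc n) φ → 𝓔 n (suc k) ψ → 𝓔 n (suc k) (φ ∨ ψ)
    imp< : ∀ {k φ ψ} → n < k → 𝓓 n n φ → 𝓔 n (suc k) ψ → 𝓔 n (suc k) (φ ⇒ ψ)

  data 𝓤 {L : Signature} (n : ℕ) : ℕ → Formula L → Set where
    qf  : ∀ {φ} → QuantifierFree φ → 𝓤 n 0 φ

    𝓓→𝓤 : ∀ {k φ} → 𝓓 n k φ → 𝓤 n (suc k) φ
    and : ∀ {k φ ψ} → 𝓤 n (suc k) φ → 𝓤 n (suc k) ψ → 𝓤 n (suc k) (φ ∧ ψ)
    all : ∀ {k x φ} → 𝓤 n (suc k) φ → 𝓤 n (suc k) (∀′ x φ)

    or>  : ∀ {k φ ψ} → n > k → 𝓤 n (suc k) φ → 𝓤 n (suc k) ψ → 𝓤 n (suc k) (φ ∨ ψ)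
    imp> : ∀ {k φ ψ} → n > k → 𝓔 n (suc k) φ → 𝓤 n (suc k) ψ → 𝓤 n (suc k) (φ ⇒ ψ)

    orʳ≡ : ∀ {k φ ψ} → n ≡ k → 𝓤 n (suc k) φ → 𝓓 n k ψ → 𝓤 n (suc k) (φ ∨ ψ)
    orˡ≡ : ∀ {k φ ψ} → n ≡ k → 𝓓 n k φ → 𝓤 n (suc k) ψ → 𝓤 n (suc k) (φ ∨ ψ)
    imp≡ : ∀ {k φ ψ} → n ≡ k → 𝓔 n (suc k) φ → 𝓤 n (suc k) ψ → 𝓤 n (suc k) (φ ⇒ ψ)

    orʳ< : ∀ {k φ ψ} → n < k → 𝓤 n (suc k) φ → 𝓓 n n ψ → 𝓤 n (suc k) (φ ∨ ψ)
    orˡ< : ∀ {k φ ψ} → n < k → 𝓓 n n φ → 𝓤 n (suc k) ψ → 𝓤 n (suc k) (φ ∨ ψ)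
    imp< : ∀ {k φ ψ} → n < k → 𝓔 n (suc n) φ → 𝓤 n (suc k) ψ → 𝓤 n (suc k) (φ ⇒ ψ)

  𝓓 : {L : Signature} → ℕ → ℕ → Formula L → Set
  𝓓 n k φ = 𝓔 n k φ ⊎ 𝓤 n k φ

------------------------------------------------------------------------
-- Alternation paths and the classes Eₖ⁺, Uₖ⁺, Cₖ⁺

Path : Set
Path = List Sign

_^⊥ : Path → Path
s ^⊥ = map opposite s

-- c ◃ s is s if i(s) = c, and cs otherwise.
_◃_ : Sign → Path → Path
⊕ ◃ (⊕ ∷ s) = ⊕ ∷ s
⊖ ◃ (⊖ ∷ s) = ⊖ ∷ s
c ◃ s       = c ∷ s

-- The finite set Alt(φ) as a list, possibly with repetitions.  The clause
-- Alt(φ) = {⟨⟩} for quantifier-free compound φ need not be separated: there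
-- the clauses for the connectives yield a list all of whose entries are ⟨⟩.
-- Every path in Alt φ is alternating by construction.
Alt : Formula L → List Path
Alt (rel R ts) = [] ∷ []
Alt ⊥′         = [] ∷ []
Alt (φ ∧ ψ)    = Alt φ ++ Alt ψ
Alt (φ ∨ ψ)    = Alt φ ++ Alt ψ
Alt (φ ⇒ ψ)    = map _^⊥ (Alt φ) ++ Alt ψ
Alt (∀′ x φ)   = map (⊖ ◃_) (Alt φ)
Alt (∃′ x φ)   = map (⊕ ◃_) (Alt φ)

-- Alt φ is never empty, so the base value 0 plays no role.
deg : Formula L → ℕ
deg φ = max 0 (map length (Alt φ))

F : ℕ → Formula L → Set
F k φ = deg φ ≡ k

E U : ℕ → Formula L → Set
E zero    φ = F zero φ
E (suc k) φ = F (suc k) φ × (∀ s → s ∈ Alt φ → length s ≡ suc k → head s ≡ just ⊕)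
U zero    φ = F zero φ
U (suc k) φ = F (suc k) φ × (∀ s → s ∈ Alt φ → length s ≡ suc k → head s ≡ just ⊖)

E⁺ U⁺ C⁺ : ℕ → Formula L → Set
E⁺ k φ = E k φ ⊎ ∃[ i ] (i < k × F i φ)
U⁺ k φ = U k φ ⊎ ∃[ i ] (i < k × F i φ)
C⁺ k φ = E⁺ k φ ⊎ U⁺ k φ

------------------------------------------------------------------------
-- Prenex normalisation

data Rule {L : Signature} (n : ℕ) : Formula L → Formula L → Set where
  ∃⇒ : ∀ {x ξ δ} → ¬ x ∈FV δ → Rule n (∃′ x ξ ⇒ δ) (∀′ x (ξ ⇒ δ))
  ∀⇒ : ∀ {x ξ δ} → ¬ x ∈FV δ → n ≢ 0 → U⁺ n ξ → Rule n (∀′ x ξ ⇒ δ) (∃′ x (ξ ⇒ δ))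
  ⇒∃ : ∀ {x ξ δ} → ¬ x ∈FV δ → C⁺ n δ → Rule n (δ ⇒ ∃′ x ξ) (∃′ x (δ ⇒ ξ))
  ⇒∀ : ∀ {x ξ δ} → ¬ x ∈FV δ → Rule n (δ ⇒ ∀′ x ξ) (∀′ x (δ ⇒ ξ))

  ∃∧ : ∀ {x ξ δ} → ¬ x ∈FV δ → Rule n (∃′ x ξ ∧ δ) (∃′ x (ξ ∧ δ))
  ∀∧ : ∀ {x ξ δ} → ¬ x ∈FV δ → Rule n (∀′ x ξ ∧ δ) (∀′ x (ξ ∧ δ))
  ∧∃ : ∀ {x ξ δ} → ¬ x ∈FV δ → Rule n (δ ∧ ∃′ x ξ) (∃′ x (δ ∧ ξ))
  ∧∀ : ∀ {x ξ δ} → ¬ x ∈FV δ → Rule n (δ ∧ ∀′ x ξ) (∀′ x (δ ∧ ξ))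

  ∃∨ : ∀ {x ξ δ} → ¬ x ∈FV δ → Rule n (∃′ x ξ ∨ δ) (∃′ x (ξ ∨ δ))
  ∨∃ : ∀ {x ξ δ} → ¬ x ∈FV δ → Rule n (δ ∨ ∃′ x ξ) (∃′ x (δ ∨ ξ))
  ∀∨ : ∀ {x ξ δ} → ¬ x ∈FV δ → C⁺ n δ → Rule n (∀′ x ξ ∨ δ) (∀′ x (ξ ∨ δ))
  ∨∀ : ∀ {x ξ δ} → ¬ x ∈FV δ → C⁺ n δ → Rule n (δ ∨ ∀′ x ξ) (∀′ x (δ ∨ ξ))

  ∃-var : ∀ {x y ξ} → ¬ y appearsIn ξ → Rule n (∃′ x ξ) (∃′ y (ξ [ x ≔ y ]))
  ∀-var : ∀ {x y ξ} → ¬ y appearsIn ξ → Rule n (∀′ x ξ) (∀′ y (ξ [ x ≔ y ]))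

data _⊢_⇝_ {L : Signature} (n : ℕ) : Formula L → Formula L → Set where
  rule : ∀ {φ ψ} → (∀ χ → ProperSubformula χ φ → IsPrenex χ) → Rule n φ ψ → n ⊢ φ ⇝ ψ

  ∧ˡ : ∀ {φ φ′ ψ} → n ⊢ φ ⇝ φ′ → n ⊢ (φ ∧ ψ) ⇝ (φ′ ∧ ψ)
  ∧ʳ : ∀ {φ ψ ψ′} → n ⊢ ψ ⇝ ψ′ → n ⊢ (φ ∧ ψ) ⇝ (φ ∧ ψ′)
  ∨ˡ : ∀ {φ φ′ ψ} → n ⊢ φ ⇝ φ′ → n ⊢ (φ ∨ ψ) ⇝ (φ′ ∨ ψ)
  ∨ʳ : ∀ {φ ψ ψ′} → n ⊢ ψ ⇝ ψ′ → n ⊢ (φ ∨ ψ) ⇝ (φ ∨ ψ′)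
  ⇒ˡ : ∀ {φ φ′ ψ} → n ⊢ φ ⇝ φ′ → n ⊢ (φ ⇒ ψ) ⇝ (φ′ ⇒ ψ)
  ⇒ʳ : ∀ {φ ψ ψ′} → n ⊢ ψ ⇝ ψ′ → n ⊢ (φ ⇒ ψ) ⇝ (φ ⇒ ψ′)
  ∀ᶜ : ∀ {x φ φ′} → n ⊢ φ ⇝ φ′ → n ⊢ ∀′ x φ ⇝ ∀′ x φ′
  ∃ᶜ : ∀ {x φ φ′} → n ⊢ φ ⇝ φ′ → n ⊢ ∃′ x φ ⇝ ∃′ x φ′

_⊢_⇝*_ : {L : Signature} → ℕ → Formula L → Formula L → Set
n ⊢ φ ⇝* ψ = Star (n ⊢_⇝_) φ ψ

{-# OPTIONS --safe #-}

-- From left to right, the prenex forms of the immediate subformulas are merged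
-- by interleaving their quantifier prefixes.  The side conditions depend only
-- on the signs of the prefixes, and moving the larger prefix block by block
-- until both are low keeps the number of alternations within the bound.
--
-- From right to left, Σₖ⁺ ⊆ 𝓔ⁿₖ and Πₖ⁺ ⊆ 𝓤ⁿₖ, and both classes are closed under
-- inverse steps: if a compound formula lies in a class then so do its
-- components (with the dual class for antecedents).  The sharper bound required
-- of one component at higher levels comes from the side condition, as
-- Eₙ⁺ ⊆ 𝓔ⁿₙ and Uₙ⁺ ⊆ 𝓤ⁿₙ, or, for rules without one, from the compound formula.

module Submission where

open import Defs
open import Data.Empty using (⊥-elim)
open import Data.List.Base using (List; []; _∷_; head; length; map)
open import Data.List.Extrema.Nat using (xs≤max; max≤v⁺)
open import Data.List.Membership.Propositional using (_∈_)
open import Data.List.NonEmpty.Base using (_∷_)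
open import Data.List.Properties using (length-map)
open import Data.List.Relation.Unary.All as All using (All; []; _∷_)
open import Data.List.Relation.Unary.All.Properties using (map⁺; map⁻; ++⁺; ++⁻)
open import Data.Maybe.Base using (just)
open import Data.Nat.Base using (ℕ; zero; suc; _≤_; _<_; z≤n; s≤s; s≤s⁻¹; _⊔_)
open import Data.Nat.Properties using (_≟_; ≤-refl; ≤-trans; ≤-reflexive; <-irrefl;
  <-cmp; n≤1+n; m≤n⇒m≤1+n; m≤n⇒m<n∨m≡n; m<n⇒m<n⊔o; m<n⇒m<o⊔n; n<1+n)
open import Data.Product.Base using (∃-syntax; _×_; _,_; proj₁; proj₂)
open import Data.Sign.Base using (Sign; opposite) renaming (+ to ⊕; - to ⊖)
open import Data.Sum.Base using (_⊎_; inj₁; inj₂)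
open import Data.Unit.Base using (⊤; tt)
open import Data.Vec.Base using (Vec; []; _∷_)
open import Data.Vec.Relation.Unary.Any using (Any; here; there)
open import Function.Base using (_∘_)
open import Function.Bundles using (_⇔_; mk⇔)
open import Relation.Binary.Construct.Closure.ReflexiveTransitive
  using (ε; _◅_; _◅◅_; gmap)
open import Relation.Binary.Construct.Closure.Transitive using ([_]; _∷_)
open import Relation.Binary.Definitions using (tri<; tri≈; tri>)
open import Relation.Binary.PropositionalEquality
  using (_≡_; _≢_; refl; sym; cong; subst)
open import Relation.Nullary.Decidable.Core using (yes; no)
open import Relation.Nullary.Negation.Core using (¬_)

-- Renaming bound variables

infix 4 _≈_

-- Coarser than renaming: terms inside atoms and names of bound variables are both forgotten.
-- Membership in `𝓔` and `𝓤` and the quantifier prefix depend only on the remaining skeleton, so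
-- capture need not be considered.
data _≈_ {L : Signature} : Formula L → Formula L → Set where
  rel : ∀ {R ts us} → rel R ts ≈ rel R us
  ⊥′  : ⊥′ ≈ ⊥′
  _∧_ : ∀ {φ φ′ ψ ψ′} → φ ≈ φ′ → ψ ≈ ψ′ → φ ∧ ψ ≈ φ′ ∧ ψ′
  _∨_ : ∀ {φ φ′ ψ ψ′} → φ ≈ φ′ → ψ ≈ ψ′ → φ ∨ ψ ≈ φ′ ∨ ψ′
  _⇒_ : ∀ {φ φ′ ψ ψ′} → φ ≈ φ′ → ψ ≈ ψ′ → φ ⇒ ψ ≈ φ′ ⇒ ψ′
  ∀′  : ∀ {x y φ φ′} → φ ≈ φ′ → ∀′ x φ ≈ ∀′ y φ′
  ∃′  : ∀ {x y φ φ′} → φ ≈ φ′ → ∃′ x φ ≈ ∃′ y φ′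

≈-refl : (φ : Formula L) → φ ≈ φ
≈-refl (rel R ts) = rel
≈-refl ⊥′         = ⊥′
≈-refl (φ ∧ ψ)    = ≈-refl φ ∧ ≈-refl ψ
≈-refl (φ ∨ ψ)    = ≈-refl φ ∨ ≈-refl ψ
≈-refl (φ ⇒ ψ)    = ≈-refl φ ⇒ ≈-refl ψ
≈-refl (∀′ x φ)   = ∀′ (≈-refl φ)
≈-refl (∃′ x φ)   = ∃′ (≈-refl φ)

≈-sym : {φ ψ : Formula L} → φ ≈ ψ → ψ ≈ φ
≈-sym rel     = rel
≈-sym ⊥′      = ⊥′
≈-sym (p ∧ q) = ≈-sym p ∧ ≈-sym q
≈-sym (p ∨ q) = ≈-sym p ∨ ≈-sym q
≈-sym (p ⇒ q) = ≈-sym p ⇒ ≈-sym q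
≈-sym (∀′ p)  = ∀′ (≈-sym p)
≈-sym (∃′ p)  = ∃′ (≈-sym p)

≈-subst : ∀ x y (φ : Formula L) → φ ≈ φ [ x ≔ y ]
≈-subst x y (rel R ts) = rel
≈-subst x y ⊥′         = ⊥′
≈-subst x y (φ ∧ ψ)    = ≈-subst x y φ ∧ ≈-subst x y ψ
≈-subst x y (φ ∨ ψ)    = ≈-subst x y φ ∨ ≈-subst x y ψ
≈-subst x y (φ ⇒ ψ)    = ≈-subst x y φ ⇒ ≈-subst x y ψ
≈-subst x y (∀′ z φ) with z ≟ x
... | yes _ = ∀′ (≈-refl φ)
... | no  _ = ∀′ (≈-subst x y φ)
≈-subst x y (∃′ z φ) with z ≟ x
... | yes _ = ∃′ (≈-refl φ)
... | no  _ = ∃′ (≈-subst x y φ)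

QuantifierFree-resp-≈ : {φ ψ : Formula L} → φ ≈ ψ → QuantifierFree φ → QuantifierFree ψ
QuantifierFree-resp-≈ rel     rel     = rel
QuantifierFree-resp-≈ ⊥′      ⊥′      = ⊥′
QuantifierFree-resp-≈ (p ∧ q) (a ∧ b) = QuantifierFree-resp-≈ p a ∧ QuantifierFree-resp-≈ q b
QuantifierFree-resp-≈ (p ∨ q) (a ∨ b) = QuantifierFree-resp-≈ p a ∨ QuantifierFree-resp-≈ q b
QuantifierFree-resp-≈ (p ⇒ q) (a ⇒ b) = QuantifierFree-resp-≈ p a ⇒ QuantifierFree-resp-≈ q b

mutual
  𝓔-resp-≈ : ∀ {n k} {φ ψ : Formula L} → φ ≈ ψ → 𝓔 n k φ → 𝓔 n k ψ
  𝓔-resp-≈ p       (qf q)       = qf (QuantifierFree-resp-≈ p q)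
  𝓔-resp-≈ p       (𝓓→𝓔 d)      = 𝓓→𝓔 (𝓓-resp-≈ p d)
  𝓔-resp-≈ (p ∧ q) (and a b)    = and (𝓔-resp-≈ p a) (𝓔-resp-≈ q b)
  𝓔-resp-≈ (∃′ p)  (ex a)       = ex (𝓔-resp-≈ p a)
  𝓔-resp-≈ (p ∨ q) (or> h a b)  = or> h (𝓔-resp-≈ p a) (𝓔-resp-≈ q b)
  𝓔-resp-≈ (p ⇒ q) (imp> h a b) = imp> h (𝓤-resp-≈ p a) (𝓔-resp-≈ q b)
  𝓔-resp-≈ (p ∨ q) (or≡ h a b)  = or≡ h (𝓔-resp-≈ p a) (𝓔-resp-≈ q b)
  𝓔-resp-≈ (p ⇒ q) (imp≡ h a b) = imp≡ h (𝓓-resp-≈ p a) (𝓔-resp-≈ q b)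
  𝓔-resp-≈ (p ∨ q) (orʳ< h a b) = orʳ< h (𝓔-resp-≈ p a) (𝓔-resp-≈ q b)
  𝓔-resp-≈ (p ∨ q) (orˡ< h a b) = orˡ< h (𝓔-resp-≈ p a) (𝓔-resp-≈ q b)
  𝓔-resp-≈ (p ⇒ q) (imp< h a b) = imp< h (𝓓-resp-≈ p a) (𝓔-resp-≈ q b)

  𝓤-resp-≈ : ∀ {n k} {φ ψ : Formula L} → φ ≈ ψ → 𝓤 n k φ → 𝓤 n k ψ
  𝓤-resp-≈ p       (qf q)       = qf (QuantifierFree-resp-≈ p q)
  𝓤-resp-≈ p       (𝓓→𝓤 d)      = 𝓓→𝓤 (𝓓-resp-≈ p d)
  𝓤-resp-≈ (p ∧ q) (and a b)    = and (𝓤-resp-≈ p a) (𝓤-resp-≈ q b)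
  𝓤-resp-≈ (∀′ p)  (all a)      = all (𝓤-resp-≈ p a)
  𝓤-resp-≈ (p ∨ q) (or> h a b)  = or> h (𝓤-resp-≈ p a) (𝓤-resp-≈ q b)
  𝓤-resp-≈ (p ⇒ q) (imp> h a b) = imp> h (𝓔-resp-≈ p a) (𝓤-resp-≈ q b)
  𝓤-resp-≈ (p ∨ q) (orʳ≡ h a b) = orʳ≡ h (𝓤-resp-≈ p a) (𝓓-resp-≈ q b)
  𝓤-resp-≈ (p ∨ q) (orˡ≡ h a b) = orˡ≡ h (𝓓-resp-≈ p a) (𝓤-resp-≈ q b)
  𝓤-resp-≈ (p ⇒ q) (imp≡ h a b) = imp≡ h (𝓔-resp-≈ p a) (𝓤-resp-≈ q b)
  𝓤-resp-≈ (p ∨ q) (orʳ< h a b) = orʳ< h (𝓤-resp-≈ p a) (𝓓-resp-≈ q b)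
  𝓤-resp-≈ (p ∨ q) (orˡ< h a b) = orˡ< h (𝓓-resp-≈ p a) (𝓤-resp-≈ q b)
  𝓤-resp-≈ (p ⇒ q) (imp< h a b) = imp< h (𝓔-resp-≈ p a) (𝓤-resp-≈ q b)

  𝓓-resp-≈ : ∀ {n k} {φ ψ : Formula L} → φ ≈ ψ → 𝓓 n k φ → 𝓓 n k ψ
  𝓓-resp-≈ p (inj₁ a) = inj₁ (𝓔-resp-≈ p a)
  𝓓-resp-≈ p (inj₂ a) = inj₂ (𝓤-resp-≈ p a)

-- Monotonicity and inversion of the classes 𝓔 and 𝓤

qf⇒𝓔 : ∀ {n} k {φ : Formula L} → QuantifierFree φ → 𝓔 n k φ
qf⇒𝓔 zero    q = qf q
qf⇒𝓔 (suc k) q = 𝓓→𝓔 (inj₁ (qf⇒𝓔 k q))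

qf⇒𝓤 : ∀ {n} k {φ : Formula L} → QuantifierFree φ → 𝓤 n k φ
qf⇒𝓤 zero    q = qf q
qf⇒𝓤 (suc k) q = 𝓓→𝓤 (inj₁ (qf⇒𝓔 k q))

𝓓-mono : ∀ {n j k} {φ : Formula L} → j ≤ k → 𝓓 n j φ → 𝓓 n k φ
𝓓-mono {k = zero}  z≤n d = d
𝓓-mono {k = suc k} j≤k d with m≤n⇒m<n∨m≡n j≤k
... | inj₁ j<k  = inj₁ (𝓓→𝓔 (𝓓-mono (s≤s⁻¹ j<k) d))
... | inj₂ refl = d

𝓓⇒𝓔 : ∀ {n j k} {φ : Formula L} → j < k → 𝓓 n j φ → 𝓔 n k φ
𝓓⇒𝓔 (s≤s j≤k) d = 𝓓→𝓔 (𝓓-mono j≤k d)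

𝓓⇒𝓤 : ∀ {n j k} {φ : Formula L} → j < k → 𝓓 n j φ → 𝓤 n k φ
𝓓⇒𝓤 (s≤s j≤k) d = 𝓓→𝓤 (𝓓-mono j≤k d)

mutual
  𝓔-∧⁻¹ : ∀ {n k} {φ ψ : Formula L} → 𝓔 n k (φ ∧ ψ) → 𝓔 n k φ × 𝓔 n k ψ
  𝓔-∧⁻¹ (qf (p ∧ q)) = qf p , qf q
  𝓔-∧⁻¹ (𝓓→𝓔 d)      = let a , b = 𝓓-∧⁻¹ d in 𝓓→𝓔 a , 𝓓→𝓔 b
  𝓔-∧⁻¹ (and a b)    = a , b

  𝓤-∧⁻¹ : ∀ {n k} {φ ψ : Formula L} → 𝓤 n k (φ ∧ ψ) → 𝓤 n k φ × 𝓤 n k ψ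
  𝓤-∧⁻¹ (qf (p ∧ q)) = qf p , qf q
  𝓤-∧⁻¹ (𝓓→𝓤 d)      = let a , b = 𝓓-∧⁻¹ d in 𝓓→𝓤 a , 𝓓→𝓤 b
  𝓤-∧⁻¹ (and a b)    = a , b

  𝓓-∧⁻¹ : ∀ {n k} {φ ψ : Formula L} → 𝓓 n k (φ ∧ ψ) → 𝓓 n k φ × 𝓓 n k ψ
  𝓓-∧⁻¹ (inj₁ e) = let a , b = 𝓔-∧⁻¹ e in inj₁ a , inj₁ b
  𝓓-∧⁻¹ (inj₂ u) = let a , b = 𝓤-∧⁻¹ u in inj₂ a , inj₂ b

mutual
  -- The asymmetric clauses give one disjunct at a smaller level, from which it is raised.
  𝓔-∨⁻¹ : ∀ {n k} {φ ψ : Formula L} → 𝓔 n k (φ ∨ ψ) → 𝓔 n k φ × 𝓔 n k ψ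
  𝓔-∨⁻¹ (qf (p ∨ q))   = qf p , qf q
  𝓔-∨⁻¹ (𝓓→𝓔 d)        = let a , b = 𝓓-∨⁻¹ d in 𝓓→𝓔 a , 𝓓→𝓔 b
  𝓔-∨⁻¹ (or> _ a b)    = a , b
  𝓔-∨⁻¹ (or≡ _ a b)    = a , b
  𝓔-∨⁻¹ (orʳ< n<k a b) = a , 𝓓⇒𝓔 (s≤s n<k) (inj₁ b)
  𝓔-∨⁻¹ (orˡ< n<k a b) = 𝓓⇒𝓔 (s≤s n<k) (inj₁ a) , b

  𝓤-∨⁻¹ : ∀ {n k} {φ ψ : Formula L} → 𝓤 n k (φ ∨ ψ) → 𝓤 n k φ × 𝓤 n k ψ
  𝓤-∨⁻¹ (qf (p ∨ q))   = qf p , qf q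
  𝓤-∨⁻¹ (𝓓→𝓤 d)        = let a , b = 𝓓-∨⁻¹ d in 𝓓→𝓤 a , 𝓓→𝓤 b
  𝓤-∨⁻¹ (or> _ a b)    = a , b
  𝓤-∨⁻¹ (orʳ≡ _ a b)   = a , 𝓓→𝓤 b
  𝓤-∨⁻¹ (orˡ≡ _ a b)   = 𝓓→𝓤 a , b
  𝓤-∨⁻¹ (orʳ< n<k a b) = a , 𝓓⇒𝓤 (m≤n⇒m≤1+n n<k) b
  𝓤-∨⁻¹ (orˡ< n<k a b) = 𝓓⇒𝓤 (m≤n⇒m≤1+n n<k) a , b

  𝓓-∨⁻¹ : ∀ {n k} {φ ψ : Formula L} → 𝓓 n k (φ ∨ ψ) → 𝓓 n k φ × 𝓓 n k ψ
  𝓓-∨⁻¹ (inj₁ e) = let a , b = 𝓔-∨⁻¹ e in inj₁ a , inj₁ b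
  𝓓-∨⁻¹ (inj₂ u) = let a , b = 𝓤-∨⁻¹ u in inj₂ a , inj₂ b

mutual
  𝓔-⇒⁻¹ : ∀ {n k} {φ ψ : Formula L} → 𝓔 n k (φ ⇒ ψ) → 𝓤 n k φ × 𝓔 n k ψ
  𝓔-⇒⁻¹ (qf (p ⇒ q))   = qf p , qf q
  𝓔-⇒⁻¹ (𝓓→𝓔 d)        = let a , b = 𝓓-⇒⁻¹ d in 𝓓→𝓤 a , 𝓓→𝓔 b
  𝓔-⇒⁻¹ (imp> _ a b)   = a , b
  𝓔-⇒⁻¹ (imp≡ _ a b)   = 𝓓→𝓤 a , b
  𝓔-⇒⁻¹ (imp< n<k a b) = 𝓓⇒𝓤 (m≤n⇒m≤1+n n<k) a , b

  𝓤-⇒⁻¹ : ∀ {n k} {φ ψ : Formula L} → 𝓤 n k (φ ⇒ ψ) → 𝓔 n k φ × 𝓤 n k ψ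
  𝓤-⇒⁻¹ (qf (p ⇒ q))   = qf p , qf q
  𝓤-⇒⁻¹ (𝓓→𝓤 d)        = let a , b = 𝓓-⇒⁻¹ d in 𝓓→𝓔 a , 𝓓→𝓤 b
  𝓤-⇒⁻¹ (imp> _ a b)   = a , b
  𝓤-⇒⁻¹ (imp≡ _ a b)   = a , b
  𝓤-⇒⁻¹ (imp< n<k a b) = 𝓓⇒𝓔 (s≤s n<k) (inj₁ a) , b

  𝓓-⇒⁻¹ : ∀ {n k} {φ ψ : Formula L} → 𝓓 n k (φ ⇒ ψ) → 𝓓 n k φ × 𝓓 n k ψ
  𝓓-⇒⁻¹ (inj₁ e) = let a , b = 𝓔-⇒⁻¹ e in inj₂ a , inj₁ b
  𝓓-⇒⁻¹ (inj₂ u) = let a , b = 𝓤-⇒⁻¹ u in inj₁ a , inj₂ b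

-- Sharper bounds for one component above level `n`

mutual
  -- Every clause that forms a disjunction above level `n` already places one disjunct in
  -- `𝓔 n (suc n)` or lower. Membership inherited from below is followed downwards, at the latest to
  -- level `n`, where plain inversion suffices.
  𝓓-∨-small : ∀ {n k} {φ ψ : Formula L} → n ≤ k → 𝓓 n k (φ ∨ ψ) →
              𝓔 n (suc n) φ ⊎ 𝓔 n (suc n) ψ
  𝓓-∨-small n≤k d with m≤n⇒m<n∨m≡n n≤k
  ... | inj₂ refl = inj₁ (𝓓→𝓔 (proj₁ (𝓓-∨⁻¹ d)))
  𝓓-∨-small n≤k (inj₁ e) | inj₁ n<k = 𝓔-∨-small n<k e
  𝓓-∨-small n≤k (inj₂ u) | inj₁ n<k = 𝓤-∨-small n<k u

  𝓔-∨-small : ∀ {n k} {φ ψ : Formula L} → n < k → 𝓔 n k (φ ∨ ψ) →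
              𝓔 n (suc n) φ ⊎ 𝓔 n (suc n) ψ
  𝓔-∨-small n<k       (𝓓→𝓔 d)        = 𝓓-∨-small (s≤s⁻¹ n<k) d
  𝓔-∨-small n<k       (or> k<n _ _)  = ⊥-elim (<-irrefl refl (≤-trans n<k k<n))
  𝓔-∨-small n<k       (or≡ refl a _) = inj₁ a
  𝓔-∨-small n<k       (orʳ< _ _ b)   = inj₂ b
  𝓔-∨-small n<k       (orˡ< _ a _)   = inj₁ a

  𝓤-∨-small : ∀ {n k} {φ ψ : Formula L} → n < k → 𝓤 n k (φ ∨ ψ) →
              𝓔 n (suc n) φ ⊎ 𝓔 n (suc n) ψ
  𝓤-∨-small n<k       (𝓓→𝓤 d)         = 𝓓-∨-small (s≤s⁻¹ n<k) d
  𝓤-∨-small n<k       (or> k<n _ _)   = ⊥-elim (<-irrefl refl (≤-trans n<k k<n))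
  𝓤-∨-small n<k       (orʳ≡ refl _ b) = inj₂ (𝓓→𝓔 b)
  𝓤-∨-small n<k       (orˡ≡ refl a _) = inj₁ (𝓓→𝓔 a)
  𝓤-∨-small n<k       (orʳ< _ _ b)    = inj₂ (𝓓→𝓔 b)
  𝓤-∨-small n<k       (orˡ< _ a _)    = inj₁ (𝓓→𝓔 a)

mutual
  -- The same descent; here the bounded component is always the antecedent, so no alternative
  -- arises.
  𝓓-⇒-small : ∀ {n k} {φ ψ : Formula L} → n ≤ k → 𝓓 n k (φ ⇒ ψ) → 𝓔 n (suc n) φ
  𝓓-⇒-small n≤k d with m≤n⇒m<n∨m≡n n≤k
  ... | inj₂ refl = 𝓓→𝓔 (proj₁ (𝓓-⇒⁻¹ d))
  𝓓-⇒-small n≤k (inj₁ e) | inj₁ n<k = 𝓔-⇒-small n<k e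
  𝓓-⇒-small n≤k (inj₂ u) | inj₁ n<k = 𝓤-⇒-small n<k u

  𝓔-⇒-small : ∀ {n k} {φ ψ : Formula L} → n < k → 𝓔 n k (φ ⇒ ψ) → 𝓔 n (suc n) φ
  𝓔-⇒-small n<k (𝓓→𝓔 d)         = 𝓓-⇒-small (s≤s⁻¹ n<k) d
  𝓔-⇒-small n<k (imp> k<n _ _)  = ⊥-elim (<-irrefl refl (≤-trans n<k k<n))
  𝓔-⇒-small n<k (imp≡ refl a _) = 𝓓→𝓔 a
  𝓔-⇒-small n<k (imp< _ a _)    = 𝓓→𝓔 a

  𝓤-⇒-small : ∀ {n k} {φ ψ : Formula L} → n < k → 𝓤 n k (φ ⇒ ψ) → 𝓔 n (suc n) φ
  𝓤-⇒-small n<k (𝓓→𝓤 d)         = 𝓓-⇒-small (s≤s⁻¹ n<k) d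
  𝓤-⇒-small n<k (imp> k<n _ _)  = ⊥-elim (<-irrefl refl (≤-trans n<k k<n))
  𝓤-⇒-small n<k (imp≡ refl a _) = a
  𝓤-⇒-small n<k (imp< _ a _)    = a

-- Alternation paths

-- The least k such that the path s is allowed in a formula of Eₖ⁺ (for ⊕)
-- or Uₖ⁺ (for ⊖).
rank : Sign → Path → ℕ
rank c []      = 0
rank ⊕ (⊕ ∷ s) = suc (length s)
rank ⊕ (⊖ ∷ s) = suc (suc (length s))
rank ⊖ (⊕ ∷ s) = suc (suc (length s))
rank ⊖ (⊖ ∷ s) = suc (length s)

Ranked : Sign → ℕ → Formula L → Set
Ranked c k φ = All (λ s → rank c s ≤ k) (Alt φ)

rank≤1+length : ∀ c s → rank c s ≤ suc (length s)
rank≤1+length c []      = z≤n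
rank≤1+length ⊕ (⊕ ∷ s) = n≤1+n _
rank≤1+length ⊕ (⊖ ∷ s) = ≤-refl
rank≤1+length ⊖ (⊕ ∷ s) = ≤-refl
rank≤1+length ⊖ (⊖ ∷ s) = n≤1+n _

length≤rank : ∀ c s → length s ≤ rank c s
length≤rank c []      = z≤n
length≤rank ⊕ (⊕ ∷ s) = ≤-refl
length≤rank ⊕ (⊖ ∷ s) = n≤1+n _
length≤rank ⊖ (⊕ ∷ s) = n≤1+n _
length≤rank ⊖ (⊖ ∷ s) = ≤-refl

rank-⊥ : ∀ c s → rank c (s ^⊥) ≡ rank (opposite c) s
rank-⊥ c []      = refl
rank-⊥ ⊕ (⊕ ∷ s) = cong (suc ∘ suc) (length-map opposite s)
rank-⊥ ⊕ (⊖ ∷ s) = cong suc (length-map opposite s)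
rank-⊥ ⊖ (⊕ ∷ s) = cong suc (length-map opposite s)
rank-⊥ ⊖ (⊖ ∷ s) = cong (suc ∘ suc) (length-map opposite s)

rank≤rank-◃ : ∀ c s → rank c s ≤ rank c (c ◃ s)
rank≤rank-◃ ⊕ []      = z≤n
rank≤rank-◃ ⊖ []      = z≤n
rank≤rank-◃ ⊕ (⊕ ∷ s) = ≤-refl
rank≤rank-◃ ⊕ (⊖ ∷ s) = ≤-refl
rank≤rank-◃ ⊖ (⊕ ∷ s) = ≤-refl
rank≤rank-◃ ⊖ (⊖ ∷ s) = ≤-refl

-- A path that opens with `c` costs exactly one further alternation when it is read from the other
-- side.
rank-opposite-◃ : ∀ c s → rank (opposite c) (c ◃ s) ≡ suc (rank c (c ◃ s))
rank-opposite-◃ ⊕ []      = refl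
rank-opposite-◃ ⊖ []      = refl
rank-opposite-◃ ⊕ (⊕ ∷ s) = refl
rank-opposite-◃ ⊕ (⊖ ∷ s) = refl
rank-opposite-◃ ⊖ (⊕ ∷ s) = refl
rank-opposite-◃ ⊖ (⊖ ∷ s) = refl

0<rank-◃ : ∀ c s → 0 < rank c (c ◃ s)
0<rank-◃ ⊕ []      = s≤s z≤n
0<rank-◃ ⊖ []      = s≤s z≤n
0<rank-◃ ⊕ (⊕ ∷ s) = s≤s z≤n
0<rank-◃ ⊕ (⊖ ∷ s) = s≤s z≤n
0<rank-◃ ⊖ (⊕ ∷ s) = s≤s z≤n
0<rank-◃ ⊖ (⊖ ∷ s) = s≤s z≤n

rank-◃≤ : ∀ c s {k} → rank c s ≤ suc k → rank c (c ◃ s) ≤ suc k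
rank-◃≤ ⊕ []      h = s≤s z≤n
rank-◃≤ ⊖ []      h = s≤s z≤n
rank-◃≤ ⊕ (⊕ ∷ s) h = h
rank-◃≤ ⊕ (⊖ ∷ s) h = h
rank-◃≤ ⊖ (⊕ ∷ s) h = h
rank-◃≤ ⊖ (⊖ ∷ s) h = h

rank≤1+rank-opposite : ∀ c s → rank c s ≤ suc (rank (opposite c) s)
rank≤1+rank-opposite c s = ≤-trans (rank≤1+length c s) (s≤s (length≤rank (opposite c) s))

-- Carrying an arbitrary `P` along yields a path together with the bound known for all paths; this
-- is how a quantifier forces a level to be positive. `P` varies in the recursion because `Alt` maps
-- over the paths.
Alt-nonempty : (φ : Formula L) {P : Path → Set} → All P (Alt φ) → ∃[ s ] P s
Alt-nonempty (rel R ts) (p ∷ _) = _ , p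
Alt-nonempty ⊥′         (p ∷ _) = _ , p
Alt-nonempty (φ ∧ ψ)    ps      = Alt-nonempty φ (proj₁ (++⁻ (Alt φ) ps))
Alt-nonempty (φ ∨ ψ)    ps      = Alt-nonempty φ (proj₁ (++⁻ (Alt φ) ps))
Alt-nonempty (φ ⇒ ψ)    ps      =
  let s , p = Alt-nonempty φ (map⁻ (proj₁ (++⁻ (map _^⊥ (Alt φ)) ps))) in s ^⊥ , p
Alt-nonempty (∀′ x φ)   ps      = let s , p = Alt-nonempty φ (map⁻ ps) in ⊖ ◃ s , p
Alt-nonempty (∃′ x φ)   ps      = let s , p = Alt-nonempty φ (map⁻ ps) in ⊕ ◃ s , p

Ranked-⇒ : ∀ c {k} (φ ψ : Formula L) →
           Ranked c k (φ ⇒ ψ) → Ranked (opposite c) k φ × Ranked c k ψ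
Ranked-⇒ c {k} φ ψ r =
  let a , b = ++⁻ (map _^⊥ (Alt φ)) r
  in  All.map (λ {s} → subst (_≤ k) (rank-⊥ c s)) (map⁻ a) , b

Ranked-◃ : ∀ c {k} (φ : Formula L) → All (λ s → rank c s ≤ k) (map (c ◃_) (Alt φ)) →
           0 < k × Ranked c k φ
Ranked-◃ c φ r =
  (let s , p = Alt-nonempty φ (map⁻ r) in ≤-trans (0<rank-◃ c s) p) ,
  All.map (λ {s} → ≤-trans (rank≤rank-◃ c s)) (map⁻ r)

-- A quantifier of the wrong sign uses up one level, so the quantified formula already satisfies the
-- dual bound one level below, and so does its body.
Ranked-opposite-◃ : ∀ c {k} (φ : Formula L) →
                    All (λ s → rank (opposite c) s ≤ suc k) (map (c ◃_) (Alt φ)) →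
                    0 < k × Ranked c k φ
Ranked-opposite-◃ c {k} φ r = Ranked-◃ c φ
  (map⁺ (All.map (λ {s} p → s≤s⁻¹ (subst (_≤ suc k) (rank-opposite-◃ c s) p)) (map⁻ r)))

Ranked-zero : ∀ c (φ : Formula L) → Ranked c 0 φ → QuantifierFree φ
Ranked-zero c (rel R ts) r = rel
Ranked-zero c ⊥′         r = ⊥′
Ranked-zero c (φ ∧ ψ)    r =
  let a , b = ++⁻ (Alt φ) r in Ranked-zero c φ a ∧ Ranked-zero c ψ b
Ranked-zero c (φ ∨ ψ)    r =
  let a , b = ++⁻ (Alt φ) r in Ranked-zero c φ a ∨ Ranked-zero c ψ b
Ranked-zero c (φ ⇒ ψ)    r =
  let a , b = Ranked-⇒ c φ ψ r in Ranked-zero (opposite c) φ a ⇒ Ranked-zero c ψ b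
-- A path opened by `⊖` has positive rank on its own side and one more on the side `⊕`, so its rank
-- cannot be `0`.
Ranked-zero ⊕ (∀′ x φ)   r = let s , p = Alt-nonempty φ (map⁻ r) in
  ⊥-elim (<-irrefl refl (≤-trans (0<rank-◃ ⊖ s)
    (≤-trans (n≤1+n _) (≤-trans (≤-reflexive (sym (rank-opposite-◃ ⊖ s))) p))))
Ranked-zero ⊖ (∀′ x φ)   r with () ← proj₁ (Ranked-◃ ⊖ φ r)
Ranked-zero ⊖ (∃′ x φ)   r = let s , p = Alt-nonempty φ (map⁻ r) in
  ⊥-elim (<-irrefl refl (≤-trans (0<rank-◃ ⊕ s)
    (≤-trans (n≤1+n _) (≤-trans (≤-reflexive (sym (rank-opposite-◃ ⊕ s))) p))))
Ranked-zero ⊕ (∃′ x φ)   r with () ← proj₁ (Ranked-◃ ⊕ φ r)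

-- From alternation bounds to the classes `𝓔` and `𝓤`

mutual
  -- Up to level `n` only the symmetric clauses `or>` and `imp>` are needed, and these treat the
  -- connectives just as `Alt` does. A quantifier of the wrong sign drops to the dual class one
  -- level lower.
  Ranked⇒𝓔 : ∀ {n} k (φ : Formula L) → k ≤ n → Ranked ⊕ k φ → 𝓔 n k φ
  Ranked⇒𝓔 zero    φ          _   r = qf (Ranked-zero ⊕ φ r)
  Ranked⇒𝓔 (suc k) (rel R ts) _   r = qf⇒𝓔 (suc k) rel
  Ranked⇒𝓔 (suc k) ⊥′         _   r = qf⇒𝓔 (suc k) ⊥′
  Ranked⇒𝓔 (suc k) (φ ∧ ψ)    k<n r = let a , b = ++⁻ (Alt φ) r in
    and (Ranked⇒𝓔 (suc k) φ k<n a) (Ranked⇒𝓔 (suc k) ψ k<n b)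
  Ranked⇒𝓔 (suc k) (φ ∨ ψ)    k<n r = let a , b = ++⁻ (Alt φ) r in
    or> k<n (Ranked⇒𝓔 (suc k) φ k<n a) (Ranked⇒𝓔 (suc k) ψ k<n b)
  Ranked⇒𝓔 (suc k) (φ ⇒ ψ)    k<n r = let a , b = Ranked-⇒ ⊕ φ ψ r in
    imp> k<n (Ranked⇒𝓤 (suc k) φ k<n a) (Ranked⇒𝓔 (suc k) ψ k<n b)
  Ranked⇒𝓔 (suc k) (∃′ x φ)   k<n r = ex (Ranked⇒𝓔 (suc k) φ k<n (proj₂ (Ranked-◃ ⊕ φ r)))
  Ranked⇒𝓔 (suc k) (∀′ x φ)   k<n r with Ranked-opposite-◃ ⊖ φ r
  -- Positivity exposes `k` as `suc j`, since `all` is a clause for successor levels only.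
  ... | s≤s {n = j} _ , r′ =
    𝓓→𝓔 (inj₂ (all (Ranked⇒𝓤 (suc j) φ (≤-trans (n≤1+n _) k<n) r′)))

  Ranked⇒𝓤 : ∀ {n} k (φ : Formula L) → k ≤ n → Ranked ⊖ k φ → 𝓤 n k φ
  Ranked⇒𝓤 zero    φ          _   r = qf (Ranked-zero ⊖ φ r)
  Ranked⇒𝓤 (suc k) (rel R ts) _   r = qf⇒𝓤 (suc k) rel
  Ranked⇒𝓤 (suc k) ⊥′         _   r = qf⇒𝓤 (suc k) ⊥′
  Ranked⇒𝓤 (suc k) (φ ∧ ψ)    k<n r = let a , b = ++⁻ (Alt φ) r in
    and (Ranked⇒𝓤 (suc k) φ k<n a) (Ranked⇒𝓤 (suc k) ψ k<n b)
  Ranked⇒𝓤 (suc k) (φ ∨ ψ)    k<n r = let a , b = ++⁻ (Alt φ) r in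
    or> k<n (Ranked⇒𝓤 (suc k) φ k<n a) (Ranked⇒𝓤 (suc k) ψ k<n b)
  Ranked⇒𝓤 (suc k) (φ ⇒ ψ)    k<n r = let a , b = Ranked-⇒ ⊖ φ ψ r in
    imp> k<n (Ranked⇒𝓔 (suc k) φ k<n a) (Ranked⇒𝓤 (suc k) ψ k<n b)
  Ranked⇒𝓤 (suc k) (∀′ x φ)   k<n r = all (Ranked⇒𝓤 (suc k) φ k<n (proj₂ (Ranked-◃ ⊖ φ r)))
  Ranked⇒𝓤 (suc k) (∃′ x φ)   k<n r with Ranked-opposite-◃ ⊕ φ r
  ... | s≤s {n = j} _ , r′ =
    𝓓→𝓤 (inj₁ (ex (Ranked⇒𝓔 (suc j) φ (≤-trans (n≤1+n _) k<n) r′)))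

length≤deg : (φ : Formula L) {s : Path} → s ∈ Alt φ → length s ≤ deg φ
length≤deg φ = All.lookup (map⁻ (xs≤max 0 (map length (Alt φ))))

F⇒Ranked : ∀ c {i k} (φ : Formula L) → i < k → F i φ → Ranked c k φ
F⇒Ranked c φ i<k refl = All.tabulate λ {s} s∈ →
  ≤-trans (rank≤1+length c s) (≤-trans (s≤s (length≤deg φ s∈)) i<k)

length≤0⇒rank≤0 : ∀ c s → length s ≤ 0 → rank c s ≤ 0
length≤0⇒rank≤0 c [] _ = z≤n

rank≡length : ∀ c s → head s ≡ just c → rank c s ≡ length s
rank≡length ⊕ (⊕ ∷ s) _ = refl
rank≡length ⊖ (⊖ ∷ s) _ = refl

-- Rank exceeds length by at most one, so only paths of full length `k` are critical; for these the
-- first symbol `c` makes rank and length agree.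
length≤⇒rank≤ : ∀ c k s → length s ≤ k → (length s ≡ k → head s ≡ just c) → rank c s ≤ k
length≤⇒rank≤ c k s l≤k h with m≤n⇒m<n∨m≡n l≤k
... | inj₁ l<k = ≤-trans (rank≤1+length c s) l<k
... | inj₂ l≡k = subst (_≤ k) (sym (rank≡length c s (h l≡k))) l≤k

F0⇒Ranked : ∀ c (φ : Formula L) → F 0 φ → Ranked c 0 φ
F0⇒Ranked c φ eq = All.tabulate λ {s} s∈ →
  length≤0⇒rank≤0 c s (≤-trans (length≤deg φ s∈) (≤-reflexive eq))

Fₖ⇒Ranked : ∀ c k (φ : Formula L) → F k φ →
            (∀ s → s ∈ Alt φ → length s ≡ k → head s ≡ just c) → Ranked c k φ
Fₖ⇒Ranked c k φ eq h = All.tabulate λ {s} s∈ →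
  length≤⇒rank≤ c k s (≤-trans (length≤deg φ s∈) (≤-reflexive eq)) (h s s∈)

E⇒Ranked : ∀ k (φ : Formula L) → E k φ → Ranked ⊕ k φ
E⇒Ranked zero    φ eq       = F0⇒Ranked ⊕ φ eq
E⇒Ranked (suc k) φ (eq , h) = Fₖ⇒Ranked ⊕ (suc k) φ eq h

U⇒Ranked : ∀ k (φ : Formula L) → U k φ → Ranked ⊖ k φ
U⇒Ranked zero    φ eq       = F0⇒Ranked ⊖ φ eq
U⇒Ranked (suc k) φ (eq , h) = Fₖ⇒Ranked ⊖ (suc k) φ eq h

E⁺⇒𝓔 : ∀ {n} {φ : Formula L} → E⁺ n φ → 𝓔 n n φ
E⁺⇒𝓔 {φ = φ} (inj₁ e)             = Ranked⇒𝓔 _ φ ≤-refl (E⇒Ranked _ φ e)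
E⁺⇒𝓔 {φ = φ} (inj₂ (_ , i<n , f)) = Ranked⇒𝓔 _ φ ≤-refl (F⇒Ranked ⊕ φ i<n f)

U⁺⇒𝓤 : ∀ {n} {φ : Formula L} → U⁺ n φ → 𝓤 n n φ
U⁺⇒𝓤 {φ = φ} (inj₁ e)             = Ranked⇒𝓤 _ φ ≤-refl (U⇒Ranked _ φ e)
U⁺⇒𝓤 {φ = φ} (inj₂ (_ , i<n , f)) = Ranked⇒𝓤 _ φ ≤-refl (F⇒Ranked ⊖ φ i<n f)

C⁺⇒𝓓 : ∀ {n} {φ : Formula L} → C⁺ n φ → 𝓓 n n φ
C⁺⇒𝓓 (inj₁ e) = inj₁ (E⁺⇒𝓔 e)
C⁺⇒𝓓 (inj₂ u) = inj₂ (U⁺⇒𝓤 u)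

-- The classes 𝓔 and 𝓤 are closed under inverse normalisation steps

-- The body is inverted, the quantifier is returned to its operand, and the comparison of `n` with
-- `k` selects the clause that rebuilds the formula.
Rule-𝓔⁻¹ : ∀ {n k x} {φ χ : Formula L} → Rule n φ (∃′ x χ) →
           𝓔 n (suc k) χ → 𝓔 n (suc k) φ
Rule-𝓔⁻¹ {n = zero} (∀⇒ _ n≢0 _) e = ⊥-elim (n≢0 refl)
-- As `n` is a successor, prefixing `∀′` keeps the antecedent in `𝓤 n n`; for `n` equal to `0` this
-- level would admit no quantifier.
Rule-𝓔⁻¹ {n = suc m} {k} (∀⇒ _ _ u) e with 𝓔-⇒⁻¹ e | <-cmp (suc m) k
... | a , b | tri> _ _ h = imp> h (all a) b
... | a , b | tri≈ _ h _ = imp≡ h (subst (λ j → 𝓓 _ j _) h (inj₂ (all (U⁺⇒𝓤 u)))) b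
... | a , b | tri< h _ _ = imp< h (inj₂ (all (U⁺⇒𝓤 u))) b
Rule-𝓔⁻¹ {n = n} {k} (⇒∃ _ c) e with 𝓔-⇒⁻¹ e | <-cmp n k
... | a , b | tri> _ _ h = imp> h a (ex b)
... | a , b | tri≈ _ h _ = imp≡ h (subst (λ j → 𝓓 _ j _) h (C⁺⇒𝓓 c)) (ex b)
... | a , b | tri< h _ _ = imp< h (C⁺⇒𝓓 c) (ex b)
Rule-𝓔⁻¹ (∃∧ _) e = let a , b = 𝓔-∧⁻¹ e in and (ex a) b
Rule-𝓔⁻¹ (∧∃ _) e = let a , b = 𝓔-∧⁻¹ e in and a (ex b)
Rule-𝓔⁻¹ {n = n} {k} (∃∨ _) e with 𝓔-∨⁻¹ e | <-cmp n k
... | a , b | tri> _ _ h = or> h (ex a) b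
... | a , b | tri≈ _ h _ = or≡ h (ex a) b
-- One disjunct lies in `𝓔 n (suc n)`, a class closed under `∃′`. Hence it does not matter whether
-- this is the disjunct that regains the quantifier.
... | a , b | tri< h _ _ with 𝓔-∨-small (m≤n⇒m≤1+n h) e
...   | inj₁ a′ = orˡ< h (ex a′) b
...   | inj₂ b′ = orʳ< h (ex a) b′
Rule-𝓔⁻¹ {n = n} {k} (∨∃ _) e with 𝓔-∨⁻¹ e | <-cmp n k
... | a , b | tri> _ _ h = or> h a (ex b)
... | a , b | tri≈ _ h _ = or≡ h a (ex b)
... | a , b | tri< h _ _ with 𝓔-∨-small (m≤n⇒m≤1+n h) e
...   | inj₁ a′ = orˡ< h a′ (ex b)
...   | inj₂ b′ = orʳ< h a (ex b′)
Rule-𝓔⁻¹ (∃-var {x} {y} {ξ} _) e = ex (𝓔-resp-≈ (≈-sym (≈-subst x y ξ)) e)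

-- For `n < k`, implications obtain their bounded antecedent from `𝓤-⇒-small`, whereas disjunctions
-- obtain their bounded disjunct from the side condition `C⁺`.
Rule-𝓤⁻¹ : ∀ {n k x} {φ χ : Formula L} → Rule n φ (∀′ x χ) →
           𝓤 n (suc k) χ → 𝓤 n (suc k) φ
Rule-𝓤⁻¹ {n = n} {k} (∃⇒ _) u with 𝓤-⇒⁻¹ u | <-cmp n k
... | a , b | tri> _ _ h = imp> h (ex a) b
... | a , b | tri≈ _ h _ = imp≡ h (ex a) b
... | a , b | tri< h _ _ = imp< h (ex (𝓤-⇒-small (m≤n⇒m≤1+n h) u)) b
Rule-𝓤⁻¹ {n = n} {k} (⇒∀ _) u with 𝓤-⇒⁻¹ u | <-cmp n k
... | a , b | tri> _ _ h = imp> h a (all b)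
... | a , b | tri≈ _ h _ = imp≡ h a (all b)
... | a , b | tri< h _ _ = imp< h (𝓤-⇒-small (m≤n⇒m≤1+n h) u) (all b)
Rule-𝓤⁻¹ (∀∧ _) u = let a , b = 𝓤-∧⁻¹ u in and (all a) b
Rule-𝓤⁻¹ (∧∀ _) u = let a , b = 𝓤-∧⁻¹ u in and a (all b)
Rule-𝓤⁻¹ {n = n} {k} (∀∨ _ c) u with 𝓤-∨⁻¹ u | <-cmp n k
... | a , b | tri> _ _ h = or> h (all a) b
... | a , b | tri≈ _ h _ = orʳ≡ h (all a) (subst (λ j → 𝓓 _ j _) h (C⁺⇒𝓓 c))
... | a , b | tri< h _ _ = orʳ< h (all a) (C⁺⇒𝓓 c)
Rule-𝓤⁻¹ {n = n} {k} (∨∀ _ c) u with 𝓤-∨⁻¹ u | <-cmp n k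
... | a , b | tri> _ _ h = or> h a (all b)
... | a , b | tri≈ _ h _ = orˡ≡ h (subst (λ j → 𝓓 _ j _) h (C⁺⇒𝓓 c)) (all b)
... | a , b | tri< h _ _ = orˡ< h (C⁺⇒𝓓 c) (all b)
Rule-𝓤⁻¹ (∀-var {x} {y} {ξ} _) u = all (𝓤-resp-≈ (≈-sym (≈-subst x y ξ)) u)

-- Every rule yields a formula that starts with a quantifier, and congruence keeps that quantifier
-- inside the result.
⇝-¬QuantifierFree : ∀ {n} {φ ψ : Formula L} → n ⊢ φ ⇝ ψ → ¬ QuantifierFree ψ
⇝-¬QuantifierFree (∧ˡ s) (p ∧ q) = ⇝-¬QuantifierFree s p
⇝-¬QuantifierFree (∧ʳ s) (p ∧ q) = ⇝-¬QuantifierFree s q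
⇝-¬QuantifierFree (∨ˡ s) (p ∨ q) = ⇝-¬QuantifierFree s p
⇝-¬QuantifierFree (∨ʳ s) (p ∨ q) = ⇝-¬QuantifierFree s q
⇝-¬QuantifierFree (⇒ˡ s) (p ⇒ q) = ⇝-¬QuantifierFree s p
⇝-¬QuantifierFree (⇒ʳ s) (p ⇒ q) = ⇝-¬QuantifierFree s q
⇝-¬QuantifierFree (rule _ ()) rel
⇝-¬QuantifierFree (rule _ ()) ⊥′
⇝-¬QuantifierFree (rule _ ()) (_ ∧ _)
⇝-¬QuantifierFree (rule _ ()) (_ ∨ _)
⇝-¬QuantifierFree (rule _ ()) (_ ⇒ _)

mutual
  -- By induction on the membership of `ψ`. The result of a rule is a quantified formula, so a rule
  -- at the root meets only `ex` or a membership inherited from below; congruence steps pass to the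
  -- component concerned.
  ⇝-𝓔⁻¹ : ∀ {n k} {φ ψ : Formula L} → n ⊢ φ ⇝ ψ → 𝓔 n k ψ → 𝓔 n k φ
  ⇝-𝓔⁻¹ s          (qf q)       = ⊥-elim (⇝-¬QuantifierFree s q)
  ⇝-𝓔⁻¹ s          (𝓓→𝓔 d)      = 𝓓→𝓔 (⇝-𝓓⁻¹ s d)
  ⇝-𝓔⁻¹ (rule _ r) (ex a)       = Rule-𝓔⁻¹ r a
  ⇝-𝓔⁻¹ (∃ᶜ s)     (ex a)       = ex (⇝-𝓔⁻¹ s a)
  ⇝-𝓔⁻¹ (∧ˡ s)     (and a b)    = and (⇝-𝓔⁻¹ s a) b
  ⇝-𝓔⁻¹ (∧ʳ s)     (and a b)    = and a (⇝-𝓔⁻¹ s b)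
  ⇝-𝓔⁻¹ (∨ˡ s)     (or> h a b)  = or> h (⇝-𝓔⁻¹ s a) b
  ⇝-𝓔⁻¹ (∨ʳ s)     (or> h a b)  = or> h a (⇝-𝓔⁻¹ s b)
  ⇝-𝓔⁻¹ (∨ˡ s)     (or≡ h a b)  = or≡ h (⇝-𝓔⁻¹ s a) b
  ⇝-𝓔⁻¹ (∨ʳ s)     (or≡ h a b)  = or≡ h a (⇝-𝓔⁻¹ s b)
  ⇝-𝓔⁻¹ (∨ˡ s)     (orʳ< h a b) = orʳ< h (⇝-𝓔⁻¹ s a) b
  ⇝-𝓔⁻¹ (∨ʳ s)     (orʳ< h a b) = orʳ< h a (⇝-𝓔⁻¹ s b)
  ⇝-𝓔⁻¹ (∨ˡ s)     (orˡ< h a b) = orˡ< h (⇝-𝓔⁻¹ s a) b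
  ⇝-𝓔⁻¹ (∨ʳ s)     (orˡ< h a b) = orˡ< h a (⇝-𝓔⁻¹ s b)
  ⇝-𝓔⁻¹ (⇒ˡ s)     (imp> h a b) = imp> h (⇝-𝓤⁻¹ s a) b
  ⇝-𝓔⁻¹ (⇒ʳ s)     (imp> h a b) = imp> h a (⇝-𝓔⁻¹ s b)
  ⇝-𝓔⁻¹ (⇒ˡ s)     (imp≡ h a b) = imp≡ h (⇝-𝓓⁻¹ s a) b
  ⇝-𝓔⁻¹ (⇒ʳ s)     (imp≡ h a b) = imp≡ h a (⇝-𝓔⁻¹ s b)
  ⇝-𝓔⁻¹ (⇒ˡ s)     (imp< h a b) = imp< h (⇝-𝓓⁻¹ s a) b
  ⇝-𝓔⁻¹ (⇒ʳ s)     (imp< h a b) = imp< h a (⇝-𝓔⁻¹ s b)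
  ⇝-𝓔⁻¹ (rule _ ()) (and _ _)
  ⇝-𝓔⁻¹ (rule _ ()) (or> _ _ _)
  ⇝-𝓔⁻¹ (rule _ ()) (or≡ _ _ _)
  ⇝-𝓔⁻¹ (rule _ ()) (orʳ< _ _ _)
  ⇝-𝓔⁻¹ (rule _ ()) (orˡ< _ _ _)
  ⇝-𝓔⁻¹ (rule _ ()) (imp> _ _ _)
  ⇝-𝓔⁻¹ (rule _ ()) (imp≡ _ _ _)
  ⇝-𝓔⁻¹ (rule _ ()) (imp< _ _ _)

  ⇝-𝓤⁻¹ : ∀ {n k} {φ ψ : Formula L} → n ⊢ φ ⇝ ψ → 𝓤 n k ψ → 𝓤 n k φ
  ⇝-𝓤⁻¹ s          (qf q)       = ⊥-elim (⇝-¬QuantifierFree s q)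
  ⇝-𝓤⁻¹ s          (𝓓→𝓤 d)      = 𝓓→𝓤 (⇝-𝓓⁻¹ s d)
  ⇝-𝓤⁻¹ (rule _ r) (all a)      = Rule-𝓤⁻¹ r a
  ⇝-𝓤⁻¹ (∀ᶜ s)     (all a)      = all (⇝-𝓤⁻¹ s a)
  ⇝-𝓤⁻¹ (∧ˡ s)     (and a b)    = and (⇝-𝓤⁻¹ s a) b
  ⇝-𝓤⁻¹ (∧ʳ s)     (and a b)    = and a (⇝-𝓤⁻¹ s b)
  ⇝-𝓤⁻¹ (∨ˡ s)     (or> h a b)  = or> h (⇝-𝓤⁻¹ s a) b
  ⇝-𝓤⁻¹ (∨ʳ s)     (or> h a b)  = or> h a (⇝-𝓤⁻¹ s b)
  ⇝-𝓤⁻¹ (∨ˡ s)     (orʳ≡ h a b) = orʳ≡ h (⇝-𝓤⁻¹ s a) b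
  ⇝-𝓤⁻¹ (∨ʳ s)     (orʳ≡ h a b) = orʳ≡ h a (⇝-𝓓⁻¹ s b)
  ⇝-𝓤⁻¹ (∨ˡ s)     (orˡ≡ h a b) = orˡ≡ h (⇝-𝓓⁻¹ s a) b
  ⇝-𝓤⁻¹ (∨ʳ s)     (orˡ≡ h a b) = orˡ≡ h a (⇝-𝓤⁻¹ s b)
  ⇝-𝓤⁻¹ (∨ˡ s)     (orʳ< h a b) = orʳ< h (⇝-𝓤⁻¹ s a) b
  ⇝-𝓤⁻¹ (∨ʳ s)     (orʳ< h a b) = orʳ< h a (⇝-𝓓⁻¹ s b)
  ⇝-𝓤⁻¹ (∨ˡ s)     (orˡ< h a b) = orˡ< h (⇝-𝓓⁻¹ s a) b
  ⇝-𝓤⁻¹ (∨ʳ s)     (orˡ< h a b) = orˡ< h a (⇝-𝓤⁻¹ s b)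
  ⇝-𝓤⁻¹ (⇒ˡ s)     (imp> h a b) = imp> h (⇝-𝓔⁻¹ s a) b
  ⇝-𝓤⁻¹ (⇒ʳ s)     (imp> h a b) = imp> h a (⇝-𝓤⁻¹ s b)
  ⇝-𝓤⁻¹ (⇒ˡ s)     (imp≡ h a b) = imp≡ h (⇝-𝓔⁻¹ s a) b
  ⇝-𝓤⁻¹ (⇒ʳ s)     (imp≡ h a b) = imp≡ h a (⇝-𝓤⁻¹ s b)
  ⇝-𝓤⁻¹ (⇒ˡ s)     (imp< h a b) = imp< h (⇝-𝓔⁻¹ s a) b
  ⇝-𝓤⁻¹ (⇒ʳ s)     (imp< h a b) = imp< h a (⇝-𝓤⁻¹ s b)
  ⇝-𝓤⁻¹ (rule _ ()) (and _ _)
  ⇝-𝓤⁻¹ (rule _ ()) (or> _ _ _)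
  ⇝-𝓤⁻¹ (rule _ ()) (orʳ≡ _ _ _)
  ⇝-𝓤⁻¹ (rule _ ()) (orˡ≡ _ _ _)
  ⇝-𝓤⁻¹ (rule _ ()) (orʳ< _ _ _)
  ⇝-𝓤⁻¹ (rule _ ()) (orˡ< _ _ _)
  ⇝-𝓤⁻¹ (rule _ ()) (imp> _ _ _)
  ⇝-𝓤⁻¹ (rule _ ()) (imp≡ _ _ _)
  ⇝-𝓤⁻¹ (rule _ ()) (imp< _ _ _)

  ⇝-𝓓⁻¹ : ∀ {n k} {φ ψ : Formula L} → n ⊢ φ ⇝ ψ → 𝓓 n k ψ → 𝓓 n k φ
  ⇝-𝓓⁻¹ s (inj₁ e) = inj₁ (⇝-𝓔⁻¹ s e)
  ⇝-𝓓⁻¹ s (inj₂ u) = inj₂ (⇝-𝓤⁻¹ s u)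

⇝*-𝓔⁻¹ : ∀ {n k} {φ ψ : Formula L} → n ⊢ φ ⇝* ψ → 𝓔 n k ψ → 𝓔 n k φ
⇝*-𝓔⁻¹ ε        e = e
⇝*-𝓔⁻¹ (s ◅ ss) e = ⇝-𝓔⁻¹ s (⇝*-𝓔⁻¹ ss e)

⇝*-𝓤⁻¹ : ∀ {n k} {φ ψ : Formula L} → n ⊢ φ ⇝* ψ → 𝓤 n k ψ → 𝓤 n k φ
⇝*-𝓤⁻¹ ε        u = u
⇝*-𝓤⁻¹ (s ◅ ss) u = ⇝-𝓤⁻¹ s (⇝*-𝓤⁻¹ ss u)

-- Prenex formulas in the classes `𝓔` and `𝓤`

∃*-𝓔 : ∀ {n k} x xs {φ : Formula L} → 𝓔 n (suc k) φ → 𝓔 n (suc k) (∃* (x ∷ xs) φ)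
∃*-𝓔 x []       e = ex e
∃*-𝓔 x (y ∷ xs) e = ex (∃*-𝓔 y xs e)

∀*-𝓤 : ∀ {n k} x xs {φ : Formula L} → 𝓤 n (suc k) φ → 𝓤 n (suc k) (∀* (x ∷ xs) φ)
∀*-𝓤 x []       u = all u
∀*-𝓤 x (y ∷ xs) u = all (∀*-𝓤 y xs u)

mutual
  IsΣ⇒𝓔 : ∀ {n} k {φ : Formula L} → IsΣ k φ → 𝓔 n k φ
  IsΣ⇒𝓔 zero    q                          = qf q
  IsΣ⇒𝓔 (suc k) ((x ∷ xs) , _ , refl , p) = ∃*-𝓔 x xs (𝓓→𝓔 (inj₂ (IsΠ⇒𝓤 k p)))

  IsΠ⇒𝓤 : ∀ {n} k {φ : Formula L} → IsΠ k φ → 𝓤 n k φ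
  IsΠ⇒𝓤 zero    q                          = qf q
  IsΠ⇒𝓤 (suc k) ((x ∷ xs) , _ , refl , p) = ∀*-𝓤 x xs (𝓓→𝓤 (inj₁ (IsΣ⇒𝓔 k p)))

IsΣ⁺⇒𝓔 : ∀ {n k} {φ : Formula L} → IsΣ⁺ k φ → 𝓔 n k φ
IsΣ⁺⇒𝓔 (inj₁ p)                  = IsΣ⇒𝓔 _ p
IsΣ⁺⇒𝓔 (inj₂ (i , i<k , inj₁ p)) = 𝓓⇒𝓔 i<k (inj₁ (IsΣ⇒𝓔 i p))
IsΣ⁺⇒𝓔 (inj₂ (i , i<k , inj₂ p)) = 𝓓⇒𝓔 i<k (inj₂ (IsΠ⇒𝓤 i p))

IsΠ⁺⇒𝓤 : ∀ {n k} {φ : Formula L} → IsΠ⁺ k φ → 𝓤 n k φ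
IsΠ⁺⇒𝓤 (inj₁ p)                  = IsΠ⇒𝓤 _ p
IsΠ⁺⇒𝓤 (inj₂ (i , i<k , inj₁ p)) = 𝓓⇒𝓤 i<k (inj₁ (IsΣ⇒𝓔 i p))
IsΠ⁺⇒𝓤 (inj₂ (i , i<k , inj₂ p)) = 𝓓⇒𝓤 i<k (inj₂ (IsΠ⇒𝓤 i p))

-- Prenex formulas described by the signs of their quantifier prefix

quant : Sign → Var → Formula L → Formula L
quant ⊕ = ∃′
quant ⊖ = ∀′

-- Only the signs are recorded, so renaming a bound variable leaves the index unchanged.
data Prefix {L : Signature} : List Sign → Formula L → Set where
  matrix : ∀ {φ} → QuantifierFree φ → Prefix [] φ
  _∷_    : ∀ c {x ps φ} → Prefix ps φ → Prefix (c ∷ ps) (quant c x φ)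

-- Class c k ps says that a formula with prefix ps lies in Σₖ⁺ (for c = ⊕) or
-- Πₖ⁺ (for c = ⊖).
data Class : Sign → ℕ → List Sign → Set where
  nil   : ∀ {c k} → Class c k []
  same  : ∀ {c k ps} → Class c (suc k) ps → Class c (suc k) (c ∷ ps)
  lower : ∀ {c k ps} → Class (opposite c) k ps → Class c (suc k) ps

Class-suc : ∀ {c k ps} → Class c k ps → Class c (suc k) ps
Class-suc nil       = nil
Class-suc (same p)  = same (Class-suc p)
Class-suc (lower p) = lower (Class-suc p)

Class-mono : ∀ {c j k ps} → j ≤ k → Class c j ps → Class c k ps
Class-mono {k = zero}  z≤n p = p
Class-mono {k = suc k} j≤k p with m≤n⇒m<n∨m≡n j≤k
... | inj₁ j<k  = Class-suc (Class-mono (s≤s⁻¹ j<k) p)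
... | inj₂ refl = p

Class-raise : ∀ c d {j k ps} → j < k → Class c j ps → Class d k ps
Class-raise ⊕ ⊕ j<k       p = Class-mono (≤-trans (n≤1+n _) j<k) p
Class-raise ⊖ ⊖ j<k       p = Class-mono (≤-trans (n≤1+n _) j<k) p
Class-raise ⊕ ⊖ (s≤s j≤k) p = lower (Class-mono j≤k p)
Class-raise ⊖ ⊕ (s≤s j≤k) p = lower (Class-mono j≤k p)

Class-tail : ∀ {c d k ps} → Class c k (d ∷ ps) → Class c k ps
Class-tail (same p)  = p
Class-tail (lower p) = lower (Class-tail p)

IsΣ-∃ : ∀ {k x} {φ : Formula L} → IsΣ (suc k) φ → IsΣ (suc k) (∃′ x φ)
IsΣ-∃ {x = x} ((y ∷ ys) , ψ , refl , p) = (x ∷ y ∷ ys) , ψ , refl , p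

IsΠ-∀ : ∀ {k x} {φ : Formula L} → IsΠ (suc k) φ → IsΠ (suc k) (∀′ x φ)
IsΠ-∀ {x = x} ((y ∷ ys) , ψ , refl , p) = (x ∷ y ∷ ys) , ψ , refl , p

IsΠ-∃ : ∀ {k x} {φ : Formula L} → IsΠ k φ → IsΣ (suc k) (∃′ x φ)
IsΠ-∃ {x = x} p = (x ∷ []) , _ , refl , p

IsΣ-∀ : ∀ {k x} {φ : Formula L} → IsΣ k φ → IsΠ (suc k) (∀′ x φ)
IsΣ-∀ {x = x} p = (x ∷ []) , _ , refl , p

IsΣ⇒IsΣ⁺ : ∀ {j k} {φ : Formula L} → j ≤ k → IsΣ j φ → IsΣ⁺ k φ
IsΣ⇒IsΣ⁺ j≤k p with m≤n⇒m<n∨m≡n j≤k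
... | inj₁ j<k  = inj₂ (_ , j<k , inj₁ p)
... | inj₂ refl = inj₁ p

IsΠ⇒IsΠ⁺ : ∀ {j k} {φ : Formula L} → j ≤ k → IsΠ j φ → IsΠ⁺ k φ
IsΠ⇒IsΠ⁺ j≤k p with m≤n⇒m<n∨m≡n j≤k
... | inj₁ j<k  = inj₂ (_ , j<k , inj₂ p)
... | inj₂ refl = inj₁ p

IsΣ⁺-∃ : ∀ {k x} {φ : Formula L} → IsΣ⁺ (suc k) φ → IsΣ⁺ (suc k) (∃′ x φ)
IsΣ⁺-∃ (inj₁ p)                      = inj₁ (IsΣ-∃ p)
-- `IsΣ 0` and `IsΠ 0` coincide, so a quantifier-free body is read on the universal side and the
-- quantifier opens a first block.
IsΣ⁺-∃ (inj₂ (zero  , i<k , inj₁ p)) = IsΣ⇒IsΣ⁺ i<k (IsΠ-∃ p)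
IsΣ⁺-∃ (inj₂ (suc i , i<k , inj₁ p)) = inj₂ (suc i , i<k , inj₁ (IsΣ-∃ p))
IsΣ⁺-∃ (inj₂ (i     , i<k , inj₂ p)) = IsΣ⇒IsΣ⁺ i<k (IsΠ-∃ p)

IsΠ⁺-∀ : ∀ {k x} {φ : Formula L} → IsΠ⁺ (suc k) φ → IsΠ⁺ (suc k) (∀′ x φ)
IsΠ⁺-∀ (inj₁ p)                      = inj₁ (IsΠ-∀ p)
IsΠ⁺-∀ (inj₂ (zero  , i<k , inj₂ p)) = IsΠ⇒IsΠ⁺ i<k (IsΣ-∀ p)
IsΠ⁺-∀ (inj₂ (suc i , i<k , inj₂ p)) = inj₂ (suc i , i<k , inj₂ (IsΠ-∀ p))
IsΠ⁺-∀ (inj₂ (i     , i<k , inj₁ p)) = IsΠ⇒IsΠ⁺ i<k (IsΣ-∀ p)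

mutual
  Class⇒IsΣ⁺ : ∀ {k ps} {φ : Formula L} → Class ⊕ k ps → Prefix ps φ → IsΣ⁺ k φ
  Class⇒IsΣ⁺ nil       (matrix q) = IsΣ⇒IsΣ⁺ {j = 0} z≤n q
  Class⇒IsΣ⁺ (same p)  (⊕ ∷ P)    = IsΣ⁺-∃ (Class⇒IsΣ⁺ p P)
  Class⇒IsΣ⁺ (lower p) P with Class⇒IsΠ⁺ p P
  ... | inj₁ r             = inj₂ (_ , n<1+n _ , inj₂ r)
  ... | inj₂ (i , i<k , r) = inj₂ (i , m≤n⇒m≤1+n i<k , r)

  Class⇒IsΠ⁺ : ∀ {k ps} {φ : Formula L} → Class ⊖ k ps → Prefix ps φ → IsΠ⁺ k φ
  Class⇒IsΠ⁺ nil       (matrix q) = IsΠ⇒IsΠ⁺ {j = 0} z≤n q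
  Class⇒IsΠ⁺ (same p)  (⊖ ∷ P)    = IsΠ⁺-∀ (Class⇒IsΠ⁺ p P)
  Class⇒IsΠ⁺ (lower p) P with Class⇒IsΣ⁺ p P
  ... | inj₁ r             = inj₂ (_ , n<1+n _ , inj₁ r)
  ... | inj₂ (i , i<k , r) = inj₂ (i , m≤n⇒m≤1+n i<k , r)

IsPrenex-quant : ∀ c {x} {φ : Formula L} → IsPrenex φ → IsPrenex (quant c x φ)
IsPrenex-quant ⊕ (zero  , inj₁ p) = 1 , inj₁ (IsΠ-∃ p)
IsPrenex-quant ⊕ (suc k , inj₁ p) = suc k , inj₁ (IsΣ-∃ p)
IsPrenex-quant ⊕ (k     , inj₂ p) = suc k , inj₁ (IsΠ-∃ p)
IsPrenex-quant ⊖ (k     , inj₁ p) = suc k , inj₂ (IsΣ-∀ p)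
IsPrenex-quant ⊖ (zero  , inj₂ p) = 1 , inj₂ (IsΣ-∀ p)
IsPrenex-quant ⊖ (suc k , inj₂ p) = suc k , inj₂ (IsΠ-∀ p)

Prefix⇒IsPrenex : ∀ {ps} {φ : Formula L} → Prefix ps φ → IsPrenex φ
Prefix⇒IsPrenex (matrix q) = 0 , inj₁ q
Prefix⇒IsPrenex (c ∷ P)    = IsPrenex-quant c (Prefix⇒IsPrenex P)

Prefix-resp-≈ : ∀ {ps} {φ ψ : Formula L} → Prefix ps φ → φ ≈ ψ → Prefix ps ψ
Prefix-resp-≈ (matrix q) e      = matrix (QuantifierFree-resp-≈ e q)
Prefix-resp-≈ (⊕ ∷ P)    (∃′ e) = ⊕ ∷ Prefix-resp-≈ P e
Prefix-resp-≈ (⊖ ∷ P)    (∀′ e) = ⊖ ∷ Prefix-resp-≈ P e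

Prefixed : Formula L → Set
Prefixed φ = ∃[ ps ] Prefix ps φ

◂-Prefixed : ∀ {ps} {χ φ : Formula L} → Prefix ps φ → χ ◂ φ → Prefixed χ
◂-Prefixed (matrix (p ∧ q)) ∧ˡ = _ , matrix p
◂-Prefixed (matrix (p ∧ q)) ∧ʳ = _ , matrix q
◂-Prefixed (matrix (p ∨ q)) ∨ˡ = _ , matrix p
◂-Prefixed (matrix (p ∨ q)) ∨ʳ = _ , matrix q
◂-Prefixed (matrix (p ⇒ q)) ⇒ˡ = _ , matrix p
◂-Prefixed (matrix (p ⇒ q)) ⇒ʳ = _ , matrix q
◂-Prefixed (⊕ ∷ P)          ∃◂ = _ , P
◂-Prefixed (⊖ ∷ P)          ∀◂ = _ , P

-- Being prefixed passes to immediate subformulas, so the condition on all proper subformulas needs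
-- checking only at depth one.
ProperSubformula-Prefixed : {φ : Formula L} → (∀ {χ} → χ ◂ φ → Prefixed χ) →
                            ∀ {χ} → ProperSubformula χ φ → Prefixed χ
ProperSubformula-Prefixed h [ χ◂φ ]     = h χ◂φ
ProperSubformula-Prefixed h (χ◂ψ ∷ ψ◂φ) =
  ◂-Prefixed (proj₂ (ProperSubformula-Prefixed h ψ◂φ)) χ◂ψ

reduce : ∀ {n} {φ ψ : Formula L} → (∀ {χ} → χ ◂ φ → Prefixed χ) → Rule n φ ψ → n ⊢ φ ⇝ ψ
reduce h = rule λ _ χ◂φ → Prefix⇒IsPrenex (proj₂ (ProperSubformula-Prefixed h χ◂φ))

-- Side conditions read off from prefixes

QuantifierFree⇒Ranked : ∀ c {k} {φ : Formula L} → QuantifierFree φ → Ranked c k φ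
QuantifierFree⇒Ranked c rel     = z≤n ∷ []
QuantifierFree⇒Ranked c ⊥′      = z≤n ∷ []
QuantifierFree⇒Ranked c (p ∧ q) = ++⁺ (QuantifierFree⇒Ranked c p) (QuantifierFree⇒Ranked c q)
QuantifierFree⇒Ranked c (p ∨ q) = ++⁺ (QuantifierFree⇒Ranked c p) (QuantifierFree⇒Ranked c q)
QuantifierFree⇒Ranked c {k} (p ⇒ q) =
  ++⁺ (map⁺ (All.map (λ {s} → subst (_≤ k) (sym (rank-⊥ c s)))
                     (QuantifierFree⇒Ranked (opposite c) p)))
      (QuantifierFree⇒Ranked c q)

Class⇒Ranked : ∀ {c k ps} {φ : Formula L} → Class c k ps → Prefix ps φ → Ranked c k φ
Class⇒Ranked {c = c} nil       (matrix q) = QuantifierFree⇒Ranked c q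
Class⇒Ranked {c = ⊕} (same p)  (⊕ ∷ P)    = map⁺ (All.map (λ {s} → rank-◃≤ ⊕ s) (Class⇒Ranked p P))
Class⇒Ranked {c = ⊖} (same p)  (⊖ ∷ P)    = map⁺ (All.map (λ {s} → rank-◃≤ ⊖ s) (Class⇒Ranked p P))
Class⇒Ranked {c = c} (lower p) P          =
  All.map (λ {s} r → ≤-trans (rank≤1+rank-opposite c s) (s≤s r)) (Class⇒Ranked p P)

Ranked⇒deg≤ : ∀ c {k} (φ : Formula L) → Ranked c k φ → deg φ ≤ k
Ranked⇒deg≤ c φ r =
  max≤v⁺ {xs = map length (Alt φ)} z≤n (map⁺ (All.map (λ {s} → ≤-trans (length≤rank c s)) r))

rank≤length⇒head : ∀ c {k} s → rank c s ≤ suc k → length s ≡ suc k → head s ≡ just c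
rank≤length⇒head ⊕ (⊕ ∷ s) _ _    = refl
rank≤length⇒head ⊖ (⊖ ∷ s) _ _    = refl
rank≤length⇒head ⊕ (⊖ ∷ s) r refl = ⊥-elim (<-irrefl refl r)
rank≤length⇒head ⊖ (⊕ ∷ s) r refl = ⊥-elim (<-irrefl refl r)

-- If the degree is exactly `k` and positive, a path of length `k` with the wrong first symbol would
-- have rank `suc k`; a smaller degree falls under the second alternative.
Ranked⇒E⁺ : ∀ k (φ : Formula L) → Ranked ⊕ k φ → E⁺ k φ
Ranked⇒E⁺ k φ r with m≤n⇒m<n∨m≡n (Ranked⇒deg≤ ⊕ φ r)
Ranked⇒E⁺ k       φ r | inj₁ d<k = inj₂ (_ , d<k , refl)
Ranked⇒E⁺ zero    φ r | inj₂ d≡0 = inj₁ d≡0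
Ranked⇒E⁺ (suc k) φ r | inj₂ d≡k =
  inj₁ (d≡k , λ s s∈ → rank≤length⇒head ⊕ s (All.lookup r s∈))

Ranked⇒U⁺ : ∀ k (φ : Formula L) → Ranked ⊖ k φ → U⁺ k φ
Ranked⇒U⁺ k φ r with m≤n⇒m<n∨m≡n (Ranked⇒deg≤ ⊖ φ r)
Ranked⇒U⁺ k       φ r | inj₁ d<k = inj₂ (_ , d<k , refl)
Ranked⇒U⁺ zero    φ r | inj₂ d≡0 = inj₁ d≡0
Ranked⇒U⁺ (suc k) φ r | inj₂ d≡k =
  inj₁ (d≡k , λ s s∈ → rank≤length⇒head ⊖ s (All.lookup r s∈))

-- The counterpart of `C⁺ n` for prefixes.
Low : ℕ → List Sign → Set
Low n ps = ∃[ c ] Class c n ps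

Low-tail : ∀ {n c ps} → Low n (c ∷ ps) → Low n ps
Low-tail (d , p) = d , Class-tail p

Low⇒C⁺ : ∀ {n ps} {φ : Formula L} → Low n ps → Prefix ps φ → C⁺ n φ
Low⇒C⁺ (⊕ , p) P = inj₁ (Ranked⇒E⁺ _ _ (Class⇒Ranked p P))
Low⇒C⁺ (⊖ , p) P = inj₂ (Ranked⇒U⁺ _ _ (Class⇒Ranked p P))

-- Interleaving prefixes

data Connective : Set where
  conj disj imp : Connective

combine : Connective → Formula L → Formula L → Formula L
combine conj = _∧_
combine disj = _∨_
combine imp  = _⇒_

polarity : Connective → Sign → Sign
polarity conj c = c
polarity disj c = c
polarity imp  c = opposite c

-- The side conditions of the rules that move a quantifier out of the left
-- (right) operand and turn it into one of sign c; ps and qs are the prefixes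
-- of the operands without this quantifier.
Okˡ : ℕ → Connective → Sign → List Sign → List Sign → Set
Okˡ n conj c ps qs = ⊤
Okˡ n disj ⊕ ps qs = ⊤
Okˡ n disj ⊖ ps qs = Low n qs
Okˡ n imp  ⊕ ps qs = n ≢ 0 × Class ⊖ n ps
Okˡ n imp  ⊖ ps qs = ⊤

Okʳ : ℕ → Connective → Sign → List Sign → Set
Okʳ n conj c ps = ⊤
Okʳ n disj ⊕ ps = ⊤
Okʳ n disj ⊖ ps = Low n ps
Okʳ n imp  ⊕ ps = Low n ps
Okʳ n imp  ⊖ ps = ⊤

-- A derivation records, from the outermost quantifier inwards, which operand supplies the next one.
-- Each side condition refers to the prefixes that are left at that moment.
data Merge (n : ℕ) (o : Connective) : List Sign → List Sign → List Sign → Set where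
  []    : Merge n o [] [] []
  left  : ∀ c {ps qs rs} → Okˡ n o c ps qs → Merge n o ps qs rs →
          Merge n o (polarity o c ∷ ps) qs (c ∷ rs)
  right : ∀ c {ps qs rs} → Okʳ n o c ps → Merge n o ps qs rs →
          Merge n o ps (c ∷ qs) (c ∷ rs)

pullˡ : ∀ {n} o c {x ps qs} {ξ δ : Formula L} → ¬ x ∈FV δ → Prefix ps ξ → Prefix qs δ →
        Okˡ n o c ps qs →
        Rule n (combine o (quant (polarity o c) x ξ) δ) (quant c x (combine o ξ δ))
pullˡ conj ⊕ x∉ P Q ok        = ∃∧ x∉
pullˡ conj ⊖ x∉ P Q ok        = ∀∧ x∉
pullˡ disj ⊕ x∉ P Q ok        = ∃∨ x∉
pullˡ disj ⊖ x∉ P Q ok        = ∀∨ x∉ (Low⇒C⁺ ok Q)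
pullˡ imp  ⊕ x∉ P Q (n≢0 , p) = ∀⇒ x∉ n≢0 (Ranked⇒U⁺ _ _ (Class⇒Ranked p P))
pullˡ imp  ⊖ x∉ P Q ok        = ∃⇒ x∉

pullʳ : ∀ {n} o c {x ps} {ξ δ : Formula L} → ¬ x ∈FV δ → Prefix ps δ → Okʳ n o c ps →
        Rule n (combine o δ (quant c x ξ)) (quant c x (combine o δ ξ))
pullʳ conj ⊕ x∉ P ok = ∧∃ x∉
pullʳ conj ⊖ x∉ P ok = ∧∀ x∉
pullʳ disj ⊕ x∉ P ok = ∨∃ x∉
pullʳ disj ⊖ x∉ P ok = ∨∀ x∉ (Low⇒C⁺ ok P)
pullʳ imp  ⊕ x∉ P ok = ⇒∃ x∉ (Low⇒C⁺ ok P)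
pullʳ imp  ⊖ x∉ P ok = ⇒∀ x∉

combine-congˡ : ∀ {n} o {φ φ′ ψ : Formula L} → n ⊢ φ ⇝ φ′ → n ⊢ combine o φ ψ ⇝ combine o φ′ ψ
combine-congˡ conj = ∧ˡ
combine-congˡ disj = ∨ˡ
combine-congˡ imp  = ⇒ˡ

combine-congʳ : ∀ {n} o {φ ψ ψ′ : Formula L} → n ⊢ ψ ⇝ ψ′ → n ⊢ combine o φ ψ ⇝ combine o φ ψ′
combine-congʳ conj = ∧ʳ
combine-congʳ disj = ∨ʳ
combine-congʳ imp  = ⇒ʳ

quant-cong : ∀ {n} c {x} {φ φ′ : Formula L} → n ⊢ φ ⇝ φ′ → n ⊢ quant c x φ ⇝ quant c x φ′
quant-cong ⊕ = ∃ᶜ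
quant-cong ⊖ = ∀ᶜ

combine-QuantifierFree : ∀ o {φ ψ : Formula L} → QuantifierFree φ → QuantifierFree ψ →
                         QuantifierFree (combine o φ ψ)
combine-QuantifierFree conj = _∧_
combine-QuantifierFree disj = _∨_
combine-QuantifierFree imp  = _⇒_

combine-◂ : ∀ o {ps qs} {φ ψ : Formula L} → Prefix ps φ → Prefix qs ψ →
            ∀ {χ} → χ ◂ combine o φ ψ → Prefixed χ
combine-◂ conj P Q ∧ˡ = _ , P
combine-◂ conj P Q ∧ʳ = _ , Q
combine-◂ disj P Q ∨ˡ = _ , P
combine-◂ disj P Q ∨ʳ = _ , Q
combine-◂ imp  P Q ⇒ˡ = _ , P
combine-◂ imp  P Q ⇒ʳ = _ , Q

-- Fresh variables

mutual
  term-bound : (t : Term L) → ∃[ b ] ∀ {y} → y ∈ᵗ t → y < b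
  term-bound (var x)    = suc x , λ { var → n<1+n x }
  term-bound (fun f ts) = let b , h = terms-bound ts in b , λ { (fun i) → h i }

  terms-bound : ∀ {m} (ts : Vec (Term L) m) → ∃[ b ] ∀ {y} → Any (y ∈ᵗ_) ts → y < b
  terms-bound []       = 0 , λ ()
  terms-bound (t ∷ ts) =
    let b , h = term-bound t ; b′ , h′ = terms-bound ts
    in  b ⊔ b′ , λ { (here i) → m<n⇒m<n⊔o b′ (h i) ; (there i) → m<n⇒m<o⊔n b (h′ i) }

⊎-bound : {P Q : Var → Set} → ∃[ b ] (∀ {y} → P y → y < b) → ∃[ b ] (∀ {y} → Q y → y < b) →
          ∃[ b ] ∀ {y} → P y ⊎ Q y → y < b
⊎-bound (b , h) (b′ , h′) =
  b ⊔ b′ , λ { (inj₁ i) → m<n⇒m<n⊔o b′ (h i) ; (inj₂ i) → m<n⇒m<o⊔n b (h′ i) }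

formula-bound : (φ : Formula L) → ∃[ b ] ∀ {y} → y appearsIn φ → y < b
formula-bound (rel R ts) = terms-bound ts
formula-bound ⊥′         = 0 , λ ()
formula-bound (φ ∧ ψ)    = ⊎-bound (formula-bound φ) (formula-bound ψ)
formula-bound (φ ∨ ψ)    = ⊎-bound (formula-bound φ) (formula-bound ψ)
formula-bound (φ ⇒ ψ)    = ⊎-bound (formula-bound φ) (formula-bound ψ)
formula-bound (∀′ x φ)   = ⊎-bound (suc x , λ { refl → n<1+n x }) (formula-bound φ)
formula-bound (∃′ x φ)   = ⊎-bound (suc x , λ { refl → n<1+n x }) (formula-bound φ)

FV⇒appears : ∀ {x} (φ : Formula L) → x ∈FV φ → x appearsIn φ
FV⇒appears (rel R ts) i        = i
FV⇒appears (φ ∧ ψ)    (inj₁ i) = inj₁ (FV⇒appears φ i)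
FV⇒appears (φ ∧ ψ)    (inj₂ i) = inj₂ (FV⇒appears ψ i)
FV⇒appears (φ ∨ ψ)    (inj₁ i) = inj₁ (FV⇒appears φ i)
FV⇒appears (φ ∨ ψ)    (inj₂ i) = inj₂ (FV⇒appears ψ i)
FV⇒appears (φ ⇒ ψ)    (inj₁ i) = inj₁ (FV⇒appears φ i)
FV⇒appears (φ ⇒ ψ)    (inj₂ i) = inj₂ (FV⇒appears ψ i)
FV⇒appears (∀′ y φ)   (_ , i)  = inj₂ (FV⇒appears φ i)
FV⇒appears (∃′ y φ)   (_ , i)  = inj₂ (FV⇒appears φ i)

-- A strict upper bound of all variables that appear is itself fresh. Both properties are needed of
-- one variable: the first for renaming, the second for moving the quantifier across `ψ`.
fresh : (φ ψ : Formula L) → ∃[ y ] (¬ y appearsIn φ × ¬ y ∈FV ψ)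
fresh φ ψ =
  let b , h = ⊎-bound (formula-bound φ) (formula-bound ψ)
  in  b , (λ i → <-irrefl refl (h (inj₁ i))) , λ i → <-irrefl refl (h (inj₂ (FV⇒appears ψ i)))

rename : ∀ {n} c {x y ps} {ξ : Formula L} → Prefix ps ξ → ¬ y appearsIn ξ →
         n ⊢ quant c x ξ ⇝ quant c y (ξ [ x ≔ y ])
rename ⊕ P y∉ = reduce (◂-Prefixed (⊕ ∷ P)) (∃-var y∉)
rename ⊖ P y∉ = reduce (◂-Prefixed (⊖ ∷ P)) (∀-var y∉)

-- Each quantifier is first renamed to a fresh variable and then moved out; the remaining steps take
-- place below it. Renaming preserves the prefix of the body, so the rest of the merge still
-- applies.
Merge⇒⇝* : ∀ {n o ps qs rs} {φ ψ : Formula L} → Merge n o ps qs rs →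
           Prefix ps φ → Prefix qs ψ → ∃[ χ ] (Prefix rs χ × n ⊢ combine o φ ψ ⇝* χ)
Merge⇒⇝* {o = o} [] (matrix p) (matrix q) = _ , matrix (combine-QuantifierFree o p q) , ε
Merge⇒⇝* {o = o} {ψ = ψ} (left c ok m) (_∷_ .(polarity o c) {x} {φ = ξ} P) Q =
  let y , y∉ξ , y∉ψ = fresh ξ ψ
      P′            = Prefix-resp-≈ P (≈-subst x y ξ)
      χ , R , ss    = Merge⇒⇝* m P′ Q
  in  quant c y χ , c ∷ R ,
      combine-congˡ o (rename (polarity o c) P y∉ξ) ◅
      reduce (combine-◂ o (polarity o c ∷ P′) Q) (pullˡ o c y∉ψ P′ Q ok) ◅
      gmap (quant c y) (quant-cong c) ss
Merge⇒⇝* {o = o} {φ = φ} (right c ok m) P (_∷_ .c {x} {φ = ξ} Q) =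
  let y , y∉ξ , y∉φ = fresh ξ φ
      Q′            = Prefix-resp-≈ Q (≈-subst x y ξ)
      χ , R , ss    = Merge⇒⇝* m P Q′
  in  quant c y χ , c ∷ R ,
      combine-congʳ o (rename c Q y∉ξ) ◅
      reduce (combine-◂ o P (c ∷ Q′)) (pullʳ o c y∉φ P ok) ◅
      gmap (quant c y) (quant-cong c) ss

-- For disjunction, both side conditions ask that the other operand be low, so they are mirror
-- images.
Merge-swap : ∀ {n ps qs rs} → Merge n disj ps qs rs → Merge n disj qs ps rs
Merge-swap []             = []
Merge-swap (left ⊕ ok m)  = right ⊕ ok (Merge-swap m)
Merge-swap (left ⊖ ok m)  = right ⊖ ok (Merge-swap m)
Merge-swap (right ⊕ ok m) = left ⊕ ok (Merge-swap m)
Merge-swap (right ⊖ ok m) = left ⊖ ok (Merge-swap m)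

-- Merges within the alternation bound

Mergeable : ℕ → Connective → List Sign → List Sign → Sign → ℕ → Set
Mergeable n o ps qs c k = ∃[ rs ] (Merge n o ps qs rs × Class c k rs)

Mergeable-swap : ∀ {n ps qs c k} → Mergeable n disj ps qs c k → Mergeable n disj qs ps c k
Mergeable-swap (rs , m , r) = rs , Merge-swap m , r

Mergeable-lower : ∀ {n o ps qs c k} → Mergeable n o ps qs (opposite c) k →
                  Mergeable n o ps qs c (suc k)
Mergeable-lower (rs , m , r) = rs , m , lower r

-- Under this condition, which is inherited by suffixes, every interleaving
-- respects the side conditions.
Free : ℕ → Connective → List Sign → List Sign → Set
Free n conj ps qs = ⊤
Free n disj ps qs = Low n ps × Low n qs
Free n imp  ps qs = Low n ps

Free-tailˡ : ∀ {n} o {c ps qs} → Free n o (c ∷ ps) qs → Free n o ps qs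
Free-tailˡ conj f       = tt
Free-tailˡ disj (p , q) = Low-tail p , q
Free-tailˡ imp  p       = Low-tail p

Free-tailʳ : ∀ {n} o {c ps qs} → Free n o ps (c ∷ qs) → Free n o ps qs
Free-tailʳ conj f       = tt
Free-tailʳ disj (p , q) = p , Low-tail q
Free-tailʳ imp  p       = p

Free⇒Okˡ : ∀ {n} o c {ps qs} → Free n o (polarity o c ∷ ps) qs → Okˡ n o c ps qs
Free⇒Okˡ conj c f                         = tt
Free⇒Okˡ disj ⊕ f                         = tt
Free⇒Okˡ disj ⊖ (p , q)                   = q
-- A low prefix that begins with `⊖` is nonempty, so `n` is positive. Whichever sign witnesses
-- lowness, the leading `⊖` is read at a stage of sign `⊖` and level at most `n`, and the remainder
-- inherits that bound.
Free⇒Okˡ imp  ⊕ (⊖ , same p)              = (λ ()) , p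
Free⇒Okˡ imp  ⊕ (⊖ , lower (lower p))     = (λ ()) , lower (lower (Class-tail p))
Free⇒Okˡ imp  ⊕ (⊕ , lower p)             = (λ ()) , Class-suc (Class-tail p)
Free⇒Okˡ imp  ⊖ f                         = tt

Free⇒Okʳ : ∀ {n} o c {ps qs} → Free n o ps (c ∷ qs) → Okʳ n o c ps
Free⇒Okʳ conj c f       = tt
Free⇒Okʳ disj ⊕ f       = tt
Free⇒Okʳ disj ⊖ (p , q) = p
Free⇒Okʳ imp  ⊕ p       = p
Free⇒Okʳ imp  ⊖ p       = tt

polarity-opposite : ∀ o c → opposite (polarity o c) ≡ polarity o (opposite c)
polarity-opposite conj c = refl
polarity-opposite disj c = refl
polarity-opposite imp  c = refl

-- The leading blocks of both operands are moved out, the left one first, before the sign changes.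
-- Both operands then descend together, so the result spends no more alternations than either bound
-- allows.
merge-free : ∀ {n} o c k {ps qs} → Class (polarity o c) k ps → Class c k qs →
             Free n o ps qs → Mergeable n o ps qs c k
merge-free o c zero    nil       nil       f = [] , [] , nil
merge-free o c (suc k) nil       nil       f = [] , [] , nil
merge-free o c (suc k) (same p)  q         f =
  let rs , m , r = merge-free o c (suc k) p q (Free-tailˡ o f)
  in  c ∷ rs , left c (Free⇒Okˡ o c f) m , same r
merge-free o c (suc k) nil       (same q)  f =
  let rs , m , r = merge-free o c (suc k) nil q (Free-tailʳ o f)
  in  c ∷ rs , right c (Free⇒Okʳ o c f) m , same r
merge-free o c (suc k) (lower p) (same q)  f =
  let rs , m , r = merge-free o c (suc k) (lower p) q (Free-tailʳ o f)
  in  c ∷ rs , right c (Free⇒Okʳ o c f) m , same r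
merge-free o c (suc k) nil       (lower q) f =
  Mergeable-lower (merge-free o (opposite c) k nil q f)
merge-free o c (suc k) (lower p) nil       f =
  Mergeable-lower (merge-free o (opposite c) k
    (subst (λ d → Class d k _) (polarity-opposite o c) p) nil f)
merge-free o c (suc k) (lower p) (lower q) f =
  Mergeable-lower (merge-free o (opposite c) k
    (subst (λ d → Class d k _) (polarity-opposite o c) p) q f)

-- Only the leading block of the left operand is moved out; the continuation `h` receives the
-- remainder, which is in the dual class one level lower. The level of this operand may differ from
-- that of the result.
stripˡ : ∀ {n} o c {j k ps qs} → (∀ {ps′} → Okˡ n o c ps′ qs) → Class (polarity o c) (suc j) ps →
         (∀ {ps′} → Class (opposite (polarity o c)) j ps′ → Mergeable n o ps′ qs c (suc k)) →
         Mergeable n o ps qs c (suc k)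
stripˡ o c ok nil       h = h nil
stripˡ o c ok (lower p) h = h p
stripˡ o c ok (same p)  h =
  let rs , m , r = stripˡ o c ok p h in c ∷ rs , left c ok m , same r

stripʳ : ∀ {n} o c {j k ps qs} → Okʳ n o c ps → Class c (suc j) qs →
         (∀ {qs′} → Class (opposite c) j qs′ → Mergeable n o ps qs′ c (suc k)) →
         Mergeable n o ps qs c (suc k)
stripʳ o c ok nil       h = h nil
stripʳ o c ok (lower q) h = h q
stripʳ o c ok (same q)  h =
  let rs , m , r = stripʳ o c ok q h in c ∷ rs , right c ok m , same r

-- Since the right operand is low, the blocks of the left one can be moved out
-- until it is low as well.
merge-∨ : ∀ {n} c d k {ps qs} → Class c k ps → Class d n qs → Class c k qs →
          Mergeable n disj ps qs c k
merge-∨ c d zero    p q q′ = merge-free disj c zero p q′ ((c , Class-mono z≤n p) , (d , q))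
merge-∨ {n} c d (suc k) p q q′ with <-cmp n k
... | tri> _ _ k<n = merge-free disj c (suc k) p q′ ((c , Class-mono k<n p) , (d , q))
... | tri≈ _ refl _ = stripˡ disj c (ok c) p λ p′ →
  merge-free disj c (suc k) (lower p′) q′ ((opposite c , p′) , (d , q))
  where
  ok : ∀ c {ps} → Okˡ n disj c ps _
  ok ⊕ = tt
  ok ⊖ = d , q
... | tri< n<k _ _ = stripˡ disj c (ok c) p λ p′ →
  Mergeable-lower (merge-∨ (opposite c) d k p′ q (Class-raise d (opposite c) n<k q))
  where
  ok : ∀ c {ps} → Okˡ n disj c ps _
  ok ⊕ = tt
  ok ⊖ = d , q

-- Normalisation

Normal : {L : Signature} → ℕ → Sign → ℕ → Formula L → Set
Normal n c k φ = ∃[ ψ ] ∃[ ps ] (Prefix ps ψ × Class c k ps × n ⊢ φ ⇝* ψ)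

Normal-combine : ∀ {n} o {d j e l c k} {φ ψ : Formula L} →
                 (∀ {ps qs} → Class d j ps → Class e l qs → Mergeable n o ps qs c k) →
                 Normal n d j φ → Normal n e l ψ → Normal n c k (combine o φ ψ)
Normal-combine o h (φ′ , _ , P , p , ss) (ψ′ , _ , Q , q , ts) =
  let rs , m , r = h p q
      χ , R , us = Merge⇒⇝* m P Q
  in  χ , rs , R , r ,
      gmap (λ φ → combine o φ _) (combine-congˡ o) ss ◅◅
      gmap (combine o φ′) (combine-congʳ o) ts ◅◅ us

Normal-quant : ∀ {n} c {k x} {φ : Formula L} → Normal n c (suc k) φ → Normal n c (suc k) (quant c x φ)
Normal-quant c {x = x} (ψ , ps , P , p , ss) =
  quant c x ψ , c ∷ ps , c ∷ P , same p , gmap (quant c x) (quant-cong c) ss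

Normal-raise : ∀ {n} c d {j k} {φ : Formula L} → j < k → Normal n c j φ → Normal n d k φ
Normal-raise c d j<k (ψ , ps , P , p , ss) = ψ , ps , P , Class-raise c d j<k p , ss

merge-conj : ∀ {n} c {k ps qs} → Class c k ps → Class c k qs → Mergeable n conj ps qs c k
merge-conj c p q = merge-free conj c _ p q tt

merge-disj> : ∀ {n} c {k ps qs} → k ≤ n → Class c k ps → Class c k qs → Mergeable n disj ps qs c k
merge-disj> c k≤n p q = merge-free disj c _ p q ((c , Class-mono k≤n p) , (c , Class-mono k≤n q))

-- Existential quantifiers leave a disjunction unconditionally. Once both leading blocks are gone,
-- the remainders have level `n` and are low.
merge-disj≡ : ∀ {n ps qs} → Class ⊕ (suc n) ps → Class ⊕ (suc n) qs →
              Mergeable n disj ps qs ⊕ (suc n)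
merge-disj≡ p q =
  stripˡ disj ⊕ tt p λ p′ → stripʳ disj ⊕ tt q λ q′ → Mergeable-lower (merge-disj> ⊖ ≤-refl p′ q′)

-- Removing the leading blocks makes the right remainder low, which is what `merge-∨` requires of
-- it.
merge-disj< : ∀ {n k ps qs} → n < k → Class ⊕ (suc k) ps → Class ⊕ (suc n) qs →
              Mergeable n disj ps qs ⊕ (suc k)
merge-disj< n<k p q =
  stripˡ disj ⊕ tt p λ p′ → stripʳ disj ⊕ tt q λ q′ →
  Mergeable-lower (merge-∨ ⊖ ⊖ _ p′ q′ (Class-raise ⊖ ⊖ n<k q′))

merge-disj-low : ∀ {n k ps qs} d → n < k → Class ⊖ k ps → Class d n qs → Mergeable n disj ps qs ⊖ k
merge-disj-low d n<k p q = merge-∨ ⊖ d _ p q (Class-raise d ⊖ n<k q)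

merge-imp> : ∀ {n} c {k ps qs} → k ≤ n → Class (opposite c) k ps → Class c k qs →
             Mergeable n imp ps qs c k
merge-imp> c k≤n p q = merge-free imp c _ p q (opposite c , Class-mono k≤n p)

-- `Free` constrains only the antecedent of an implication, so a low antecedent can be interleaved
-- with any consequent.
merge-imp-low : ∀ {n} c d {k ps qs} → n < k → Class d n ps → Class c k qs →
                Mergeable n imp ps qs c k
merge-imp-low c d n<k p q = merge-free imp c _ (Class-raise d (opposite c) n<k p) q (d , p)

-- The leading existential block of the antecedent becomes universal without any side condition, and
-- what remains of the antecedent is low.
merge-imp≤ : ∀ {n k ps qs} → n ≤ k → Class ⊕ (suc n) ps → Class ⊖ (suc k) qs →
             Mergeable n imp ps qs ⊖ (suc k)
merge-imp≤ n≤k p q = stripˡ imp ⊖ tt p λ p′ → merge-imp-low ⊖ ⊖ (s≤s n≤k) p′ q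

mutual
  -- By induction on membership: the operands are normalised separately, and the level bounds in
  -- each clause for a connective are those under which their prefixes can be merged.
  𝓔⇒Normal : ∀ {n k} {φ : Formula L} → 𝓔 n k φ → Normal n ⊕ k φ
  𝓔⇒Normal (qf q)          = _ , [] , matrix q , nil , ε
  𝓔⇒Normal (𝓓→𝓔 d)         = let c , N = 𝓓⇒Normal d in Normal-raise c ⊕ ≤-refl N
  𝓔⇒Normal (and a b)       = Normal-combine conj (merge-conj ⊕) (𝓔⇒Normal a) (𝓔⇒Normal b)
  𝓔⇒Normal (ex a)          = Normal-quant ⊕ (𝓔⇒Normal a)
  𝓔⇒Normal (or> h a b)     = Normal-combine disj (merge-disj> ⊕ h) (𝓔⇒Normal a) (𝓔⇒Normal b)
  𝓔⇒Normal (imp> h a b)    = Normal-combine imp (merge-imp> ⊕ h) (𝓤⇒Normal a) (𝓔⇒Normal b)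
  𝓔⇒Normal (or≡ refl a b)  = Normal-combine disj merge-disj≡ (𝓔⇒Normal a) (𝓔⇒Normal b)
  𝓔⇒Normal (imp≡ refl a b) = let c , N = 𝓓⇒Normal a in
    Normal-combine imp (merge-imp-low ⊕ c ≤-refl) N (𝓔⇒Normal b)
  𝓔⇒Normal (orʳ< h a b)    = Normal-combine disj (merge-disj< h) (𝓔⇒Normal a) (𝓔⇒Normal b)
  𝓔⇒Normal (orˡ< h a b)    =
    Normal-combine disj (λ p q → Mergeable-swap (merge-disj< h q p)) (𝓔⇒Normal a) (𝓔⇒Normal b)
  𝓔⇒Normal (imp< h a b)    = let c , N = 𝓓⇒Normal a in
    Normal-combine imp (merge-imp-low ⊕ c (m≤n⇒m≤1+n h)) N (𝓔⇒Normal b)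

  𝓤⇒Normal : ∀ {n k} {φ : Formula L} → 𝓤 n k φ → Normal n ⊖ k φ
  𝓤⇒Normal (qf q)          = _ , [] , matrix q , nil , ε
  𝓤⇒Normal (𝓓→𝓤 d)         = let c , N = 𝓓⇒Normal d in Normal-raise c ⊖ ≤-refl N
  𝓤⇒Normal (and a b)       = Normal-combine conj (merge-conj ⊖) (𝓤⇒Normal a) (𝓤⇒Normal b)
  𝓤⇒Normal (all a)         = Normal-quant ⊖ (𝓤⇒Normal a)
  𝓤⇒Normal (or> h a b)     = Normal-combine disj (merge-disj> ⊖ h) (𝓤⇒Normal a) (𝓤⇒Normal b)
  𝓤⇒Normal (imp> h a b)    = Normal-combine imp (merge-imp> ⊖ h) (𝓔⇒Normal a) (𝓤⇒Normal b)
  𝓤⇒Normal (orʳ≡ refl a b) = let c , N = 𝓓⇒Normal b in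
    Normal-combine disj (merge-disj-low c ≤-refl) (𝓤⇒Normal a) N
  𝓤⇒Normal (orˡ≡ refl a b) = let c , N = 𝓓⇒Normal a in
    Normal-combine disj (λ p q → Mergeable-swap (merge-disj-low c ≤-refl q p)) N (𝓤⇒Normal b)
  𝓤⇒Normal (imp≡ refl a b) = Normal-combine imp (merge-imp≤ ≤-refl) (𝓔⇒Normal a) (𝓤⇒Normal b)
  𝓤⇒Normal (orʳ< h a b)    = let c , N = 𝓓⇒Normal b in
    Normal-combine disj (merge-disj-low c (m≤n⇒m≤1+n h)) (𝓤⇒Normal a) N
  𝓤⇒Normal (orˡ< h a b)    = let c , N = 𝓓⇒Normal a in
    Normal-combine disj (λ p q → Mergeable-swap (merge-disj-low c (m≤n⇒m≤1+n h) q p))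
                   N (𝓤⇒Normal b)
  𝓤⇒Normal (imp< h a b)    =
    Normal-combine imp (merge-imp≤ (≤-trans (n≤1+n _) h)) (𝓔⇒Normal a) (𝓤⇒Normal b)

  𝓓⇒Normal : ∀ {n k} {φ : Formula L} → 𝓓 n k φ → ∃[ c ] Normal n c k φ
  𝓓⇒Normal (inj₁ e) = ⊕ , 𝓔⇒Normal e
  𝓓⇒Normal (inj₂ u) = ⊖ , 𝓤⇒Normal u

theorem3p21 : (L : Signature) (k n : ℕ) (φ : Formula L) →
    (𝓔 n k φ ⇔ (∃[ ψ ] (IsΣ⁺ k ψ × n ⊢ φ ⇝* ψ))) ×
    (𝓤 n k φ ⇔ (∃[ ψ ] (IsΠ⁺ k ψ × n ⊢ φ ⇝* ψ)))
theorem3p21 L k n φ =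
  mk⇔ (λ e → let ψ , _ , P , p , ss = 𝓔⇒Normal e in ψ , Class⇒IsΣ⁺ p P , ss)
      (λ { (ψ , p , ss) → ⇝*-𝓔⁻¹ ss (IsΣ⁺⇒𝓔 p) }) ,
  mk⇔ (λ u → let ψ , _ , P , p , ss = 𝓤⇒Normal u in ψ , Class⇒IsΠ⁺ p P , ss)
      (λ { (ψ , p , ss) → ⇝*-𝓤⁻¹ ss (IsΠ⁺⇒𝓤 p) })
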